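{- Let $p$ be a prime, $m\in\mathbb{N}$ with $m\ge 1$, $n=p^m$, $S=\{a\in\mathbb{Z}_n \mid \gcd(a,n)=1\}$, and $\Gamma=\mathrm{Cay}(\mathbb{Z}_n,S)$. Let $v\ge 1$ be an integer and let $K_v$ be the complete graph on $v$ vertices. Then the multicone graph $K_v\bigtriangledown\Gamma$ is DS with respect to its Laplacian spectrum.
   Context: For a finite group $G$ and an inverse-closed subset $H\subseteq G$ not containing the identity, $\mathrm{Cay}(G,H)$ is the simple undirected graph with vertex set $G$ in which $x,y$ are adjacent iff $x^{ -1}y\in H$. Here $G=\mathbb{Z}_n$ is the additive cyclic group, so $x,y$ are adjacent iff $y-x\in S$. The join $\Gamma_1\bigtriangledown\Gamma_2$ is obtained from the disjoint union of $\Gamma_1$ and $\Gamma_2$ by joining every vertex of $\Gamma_1$ to every vertex of $\Gamma_2$; a multicone graph is the join of a complete graph and a regular graph. The Laplacian matrix of a finite simple graph is $L=D-A$, where $A$ is the adjacency matrix and $D$ is the diagonal matrix of vertex degrees; the Laplacian spectrum is the multiset of eigenvalues of $L$. A graph is DS with respect to its Laplacian spectrum if every finite simple graph with the same Laplacian spectrum is isomorphic to it. -}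

module Defs where

open import Algebra.Apartness.Bundles using (HeytingField; HeytingCommutativeRing)
open import Algebra.Bundles using (Group; CommutativeRing; RawRing)
open import Algebra.Structures using (IsGroup)
import Algebra.Definitions.RawMonoid as RawMonoidDefs
import Algebra.Definitions.RawSemiring as RawSemiringDefs
import Algebra.Properties.Group as GroupProperties
open import Data.Bool.Base using (if_then_else_)
open import Data.Fin.Base using (Fin; zero; suc; toℕ; punchIn; splitAt)
import Data.Fin.Properties as Fin
open import Data.List.Base using (List; length; filter; allFin; map; foldr)
open import Data.Nat.Base using (ℕ; zero; suc; _+_; _∸_; _^_; _%_; _≤_; NonZero; >-nonZero⁻¹; NonTrivial; nonTrivial⇒nonZero; nonTrivial⇒n>1; n>1⇒nonTrivial)
import Data.Nat.Properties as ℕ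
open import Data.Nat.Coprimality using (gcd≡1⇒coprime; coprime⇒gcd≡1; ¬0-coprimeTo-2+)
open import Data.Nat.Divisibility using (_∣_; ∣n∣m%n⇒∣m; ∣m+n∣m⇒∣n)
open import Data.Nat.DivMod using (_mod_; m%n<n; m<n⇒m%n≡m; m%n%n≡m%n; %-distribˡ-+; n%n≡0)
open import Data.Nat.GCD using (gcd)
open import Data.Nat.Primality using (Prime; prime⇒nonZero; prime⇒nonTrivial)
open import Data.Product.Base using (Σ-syntax; ∃-syntax; _×_; _,_)
open import Data.Sum.Base using (_⊎_; inj₁; inj₂)
open import Data.Unit.Base using (⊤; tt)
open import Function.Base using (id)
open import Function.Bundles using (_⇔_; _↔_; module Inverse)
open import Level using (0ℓ)
open import Relation.Binary.Core using (Rel)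
open import Relation.Binary.Definitions using (Decidable; Symmetric)
open import Relation.Binary.PropositionalEquality using (_≡_; _≢_; refl; sym; trans; cong; cong₂; subst; isEquivalence; module ≡-Reasoning)
open import Relation.Nullary.Decidable using (yes; does; ¬?)
open import Relation.Nullary.Negation using (¬_)
import Relation.Unary as U

record Graph (n : ℕ) : Set₁ where
  infix 4 _~_ _~?_
  field
    _~_    : Rel (Fin n) 0ℓ
    _~?_   : Decidable _~_
    ~-sym  : Symmetric _~_
    ~-irr  : ∀ x → ¬ (x ~ x)

  degree : Fin n → ℕ
  degree x = length (filter (x ~?_) (allFin n))

infix 4 _≅_

_≅_ : ∀ {m n} → Graph m → Graph n → Set
_≅_ {m} {n} G H =
  Σ[ f ∈ Fin m ↔ Fin n ] (∀ x y → (x G.~ y) ⇔ (Inverse.to f x H.~ Inverse.to f y))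
  where
  module G = Graph G
  module H = Graph H

complete : (n : ℕ) → Graph n
complete n = record
  { _~_   = _≢_
  ; _~?_  = λ x y → ¬? (x Fin.≟ y)
  ; ~-sym = λ x≢y y≡x → x≢y (sym y≡x)
  ; ~-irr = λ x x≢x → x≢x refl
  }

module Join {m n} (G : Graph m) (H : Graph n) where

  private
    module G = Graph G
    module H = Graph H

  Adj : Rel (Fin m ⊎ Fin n) 0ℓ
  Adj (inj₁ x) (inj₁ y) = x G.~ y
  Adj (inj₁ _) (inj₂ _) = ⊤
  Adj (inj₂ _) (inj₁ _) = ⊤
  Adj (inj₂ x) (inj₂ y) = x H.~ y

  adj? : Decidable Adj
  adj? (inj₁ x) (inj₁ y) = x G.~? y
  adj? (inj₁ _) (inj₂ _) = yes tt
  adj? (inj₂ _) (inj₁ _) = yes tt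
  adj? (inj₂ x) (inj₂ y) = x H.~? y

  adj-sym : ∀ x y → Adj x y → Adj y x
  adj-sym (inj₁ x) (inj₁ y) = G.~-sym
  adj-sym (inj₁ _) (inj₂ _) = id
  adj-sym (inj₂ _) (inj₁ _) = id
  adj-sym (inj₂ x) (inj₂ y) = H.~-sym

  adj-irr : ∀ x → ¬ Adj x x
  adj-irr (inj₁ x) = G.~-irr x
  adj-irr (inj₂ x) = H.~-irr x

infixr 5 _▽_

-- The first m vertices of the join are those of G, the other n those of H.
_▽_ : ∀ {m n} → Graph m → Graph n → Graph (m + n)
_▽_ {m} G H = record
  { _~_   = λ x y → Adj (splitAt m x) (splitAt m y)
  ; _~?_  = λ x y → adj? (splitAt m x) (splitAt m y)
  ; ~-sym = λ {x} {y} → adj-sym (splitAt m x) (splitAt m y)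
  ; ~-irr = λ x → adj-irr (splitAt m x)
  }
  where open Join G H

record FiniteGroup (n : ℕ) : Set where
  infixl 7 _∙_
  infix  8 _⁻¹
  field
    _∙_     : Fin n → Fin n → Fin n
    ε       : Fin n
    _⁻¹     : Fin n → Fin n
    isGroup : IsGroup _≡_ _∙_ ε _⁻¹

  group : Group 0ℓ 0ℓ
  group = record { isGroup = isGroup }

record ConnectionSet {n : ℕ} (G : FiniteGroup n) : Set₁ where
  open FiniteGroup G
  field
    Member         : U.Pred (Fin n) 0ℓ
    member?        : U.Decidable Member
    inverse-closed : ∀ {x} → Member x → Member (x ⁻¹)
    ε-free         : ¬ Member ε

Cay : ∀ {n} (G : FiniteGroup n) → ConnectionSet G → Graph n
Cay G S = record
  { _~_   = λ x y → Member (x ⁻¹ ∙ y)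
  ; _~?_  = λ x y → member? (x ⁻¹ ∙ y)
  ; ~-sym = λ {x} {y} x~y → subst Member (flip-inverse x y) (inverse-closed x~y)
  ; ~-irr = λ x x~x → ε-free (subst Member (IsGroup.inverseˡ isGroup x) x~x)
  }
  where
  open FiniteGroup G
  open ConnectionSet S
  open GroupProperties group using (⁻¹-anti-homo-∙; ⁻¹-involutive)

  flip-inverse : ∀ x y → (x ⁻¹ ∙ y) ⁻¹ ≡ y ⁻¹ ∙ x
  flip-inverse x y = trans (⁻¹-anti-homo-∙ (x ⁻¹) y) (cong (y ⁻¹ ∙_) (⁻¹-involutive x))

module IntegersMod (n : ℕ) .{{_ : NonZero n}} where

  toℕ-mod : ∀ a → toℕ (a mod n) ≡ a % n
  toℕ-mod a = Fin.toℕ-fromℕ< (m%n<n a n)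

  mod-cong : ∀ {a b} → a % n ≡ b % n → a mod n ≡ b mod n
  mod-cong {a} {b} eq =
    Fin.toℕ-injective (trans (toℕ-mod a) (trans eq (sym (toℕ-mod b))))

  mod-toℕ : ∀ (x : Fin n) → toℕ x mod n ≡ x
  mod-toℕ x =
    Fin.toℕ-injective (trans (toℕ-mod (toℕ x)) (m<n⇒m%n≡m (Fin.toℕ<n x)))

  %-absorbˡ : ∀ a b → (a % n + b) % n ≡ (a + b) % n
  %-absorbˡ a b = begin
    (a % n + b) % n          ≡⟨ %-distribˡ-+ (a % n) b n ⟩
    (a % n % n + b % n) % n  ≡⟨ cong (λ c → (c + b % n) % n) (m%n%n≡m%n a n) ⟩
    (a % n + b % n) % n      ≡⟨ %-distribˡ-+ a b n ⟨
    (a + b) % n              ∎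
    where open ≡-Reasoning

  infixl 6 _⊕_
  _⊕_ : Fin n → Fin n → Fin n
  x ⊕ y = (toℕ x + toℕ y) mod n

  0ₙ : Fin n
  0ₙ = 0 mod n

  ⊖_ : Fin n → Fin n
  ⊖ x = (n ∸ toℕ x) mod n

  ⊕-comm : ∀ x y → x ⊕ y ≡ y ⊕ x
  ⊕-comm x y = cong (_mod n) (ℕ.+-comm (toℕ x) (toℕ y))

  ⊕-assoc-aux : ∀ x y z → (x ⊕ y) ⊕ z ≡ (toℕ x + toℕ y + toℕ z) mod n
  ⊕-assoc-aux x y z = mod-cong (trans
    (cong (λ c → (c + toℕ z) % n) (toℕ-mod (toℕ x + toℕ y)))
    (%-absorbˡ (toℕ x + toℕ y) (toℕ z)))

  ⊕-assoc : ∀ x y z → (x ⊕ y) ⊕ z ≡ x ⊕ (y ⊕ z)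
  ⊕-assoc x y z = begin
    (x ⊕ y) ⊕ z                      ≡⟨ ⊕-assoc-aux x y z ⟩
    (toℕ x + toℕ y + toℕ z) mod n    ≡⟨ cong (_mod n) (ℕ.+-assoc (toℕ x) _ _) ⟩
    (toℕ x + (toℕ y + toℕ z)) mod n  ≡⟨ cong (_mod n) (ℕ.+-comm (toℕ x) _) ⟩
    (toℕ y + toℕ z + toℕ x) mod n    ≡⟨ ⊕-assoc-aux y z x ⟨
    (y ⊕ z) ⊕ x                      ≡⟨ ⊕-comm (y ⊕ z) x ⟩
    x ⊕ (y ⊕ z)                      ∎
    where open ≡-Reasoning

  ⊕-identityˡ : ∀ x → 0ₙ ⊕ x ≡ x
  ⊕-identityˡ x = trans
    (mod-cong (trans (cong (λ c → (c + toℕ x) % n) (toℕ-mod 0)) (%-absorbˡ 0 (toℕ x))))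
    (mod-toℕ x)

  ⊕-inverseˡ : ∀ x → (⊖ x) ⊕ x ≡ 0ₙ
  ⊕-inverseˡ x = mod-cong (begin
    (toℕ (⊖ x) + toℕ x) % n        ≡⟨ cong (λ c → (c + toℕ x) % n) (toℕ-mod (n ∸ toℕ x)) ⟩
    ((n ∸ toℕ x) % n + toℕ x) % n  ≡⟨ %-absorbˡ (n ∸ toℕ x) (toℕ x) ⟩
    (n ∸ toℕ x + toℕ x) % n        ≡⟨ cong (_% n) (ℕ.m∸n+n≡m (ℕ.<⇒≤ (Fin.toℕ<n x))) ⟩
    n % n                          ≡⟨ n%n≡0 n ⟩
    0                              ≡⟨ m<n⇒m%n≡m (>-nonZero⁻¹ n) ⟨
    0 % n                          ∎)
    where open ≡-Reasoning

  ℤmod : FiniteGroup n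
  ℤmod = record
    { _∙_     = _⊕_
    ; ε       = 0ₙ
    ; _⁻¹     = ⊖_
    ; isGroup = record
      { isMonoid = record
        { isSemigroup = record
          { isMagma = record { isEquivalence = isEquivalence ; ∙-cong = cong₂ _⊕_ }
          ; assoc   = ⊕-assoc
          }
        ; identity = ⊕-identityˡ , λ x → trans (⊕-comm x 0ₙ) (⊕-identityˡ x)
        }
      ; inverse = ⊕-inverseˡ , λ x → trans (⊕-comm x (⊖ x)) (⊕-inverseˡ x)
      ; ⁻¹-cong = cong ⊖_
      }
    }

  -- For n = 1 the set of units contains 0, so n ≥ 2 is needed.
  units : .{{NonTrivial n}} → ConnectionSet ℤmod
  units = record
    { Member         = λ a → gcd (toℕ a) n ≡ 1
    ; member?        = λ a → gcd (toℕ a) n ℕ.≟ 1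
    ; inverse-closed = λ {a} a∈S → coprime⇒gcd≡1 λ {d} (d∣-a , d∣n) →
        gcd≡1⇒coprime a∈S (back a (subst (d ∣_) (toℕ-mod (n ∸ toℕ a)) d∣-a) d∣n , d∣n)
    ; ε-free         = λ 0∈S → ¬0-coprimeTo-2+
        (gcd≡1⇒coprime (subst (λ a → gcd a n ≡ 1) 0ₙ≡0 0∈S))
    }
    where
    0ₙ≡0 : toℕ 0ₙ ≡ 0
    0ₙ≡0 = trans (toℕ-mod 0) (m<n⇒m%n≡m (>-nonZero⁻¹ n))

    back : ∀ {d} (a : Fin n) → d ∣ (n ∸ toℕ a) % n → d ∣ n → d ∣ toℕ a
    back {d} a d∣r d∣n = ∣m+n∣m⇒∣n
      (subst (d ∣_) (sym (ℕ.m∸n+n≡m (ℕ.<⇒≤ (Fin.toℕ<n a)))) d∣n)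
      (∣n∣m%n⇒∣m d∣n d∣r)

open IntegersMod public using (ℤmod; units)

unitaryCayley : (n : ℕ) → .{{NonTrivial n}} → Graph n
unitaryCayley n = Cay (ℤmod n) (units n)
  where instance _ = nonTrivial⇒nonZero n

primePower-nonTrivial : ∀ {p m} → Prime p → 1 ≤ m → NonTrivial (p ^ m)
primePower-nonTrivial {p} {suc m} pp _ = n>1⇒nonTrivial
  (ℕ.<-≤-trans (nonTrivial⇒n>1 p) (ℕ.m≤m*n p (p ^ m)))
  where
  instance
    _ = prime⇒nonTrivial pp
    _ = prime⇒nonZero pp
    _ = ℕ.m^n≢0 p m

Matrix : ∀ {a} → Set a → ℕ → Set a
Matrix A n = Fin n → Fin n → A

module Determinant {c ℓ} (R : RawRing c ℓ) where
  open RawRing R using (Carrier; -_; _*_; 1#; +-rawMonoid; rawSemiring)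
  open RawMonoidDefs +-rawMonoid using (sum)
  open RawSemiringDefs rawSemiring using () renaming (_^_ to _^ᴿ_)

  -- Laplace expansion along the first row.
  det : ∀ {n} → Matrix Carrier n → Carrier
  det {zero}  M = 1#
  det {suc n} M = sum λ j →
    (- 1#) ^ᴿ toℕ j * (M zero j * det λ i k → M (suc i) (punchIn j k))

-- The eigenvalues are taken in a field K of characteristic zero. Heyting
-- fields include the constructive reals, whose equality is not decidable.
module Laplacian {c ℓ₁ ℓ₂} (K : HeytingField c ℓ₁ ℓ₂) where

  open HeytingField K using (heytingCommutativeRing)
  open HeytingCommutativeRing heytingCommutativeRing using (commutativeRing)
  open CommutativeRing commutativeRing public
    using (Carrier; _≈_; _-_; 0#; 1#; rawRing) renaming (_*_ to _*ᴷ_)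
  open RawMonoidDefs (RawRing.+-rawMonoid rawRing) public
    using () renaming (_×_ to _×ᴷ_)
  open Determinant rawRing public

  CharacteristicZero : Set ℓ₁
  CharacteristicZero = ∀ k → k ×ᴷ 1# ≈ 0# → k ≡ 0

  diagonal : ∀ {n} → (Fin n → Carrier) → Matrix Carrier n
  diagonal d i j = if does (i Fin.≟ j) then d i else 0#

  module _ {n} (G : Graph n) where
    open Graph G

    adjacency : Matrix Carrier n
    adjacency i j = if does (i ~? j) then 1# else 0#

    laplacian : Matrix Carrier n
    laplacian i j = diagonal (λ x → degree x ×ᴷ 1#) i j - adjacency i j

  charPoly : ∀ {n} → Matrix Carrier n → Carrier → Carrier
  charPoly M x = det λ i j → diagonal (λ _ → x) i j - M i j

  -- σ lists the eigenvalues of M, each repeated according to its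
  -- multiplicity as a root of the characteristic polynomial. Over an
  -- infinite field a polynomial is determined by its values, so the
  -- factorisation is stated as an identity of functions of x.
  IsSpectrum : ∀ {n} → Matrix Carrier n → List Carrier → Set _
  IsSpectrum M σ = ∀ x → charPoly M x ≈ foldr _*ᴷ_ 1# (map (x -_) σ)

  -- Both graphs have σ as Laplacian spectrum; two lists are spectra of the
  -- same matrix only if they are rearrangements of each other. When K is
  -- not algebraically closed σ still exists whenever the characteristic
  -- polynomial of G splits over K, and then every H with the same
  -- eigenvalues in an extension of K has them in K.
  SameLaplacianSpectrum : ∀ {m n} → Graph m → Graph n → Set _
  SameLaplacianSpectrum G H =
    ∃[ σ ] IsSpectrum (laplacian G) σ × IsSpectrum (laplacian H) σ

  LaplacianDS : ∀ {n} → Graph n → Set _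
  LaplacianDS G = ∀ {k} (H : Graph k) → SameLaplacianSpectrum G H → H ≅ G

{-# OPTIONS --safe #-}
module Submission where

-- The complement of K_v ▽ Γ is v K₁ ∪ p K_q with q = p^(m-1), so its Laplacian
-- L̄ satisfies L̄ (L̄ - q) = 0. Conversely, if the complement of a graph satisfies
-- this equation then, reading off the entries, non-adjacency is transitive with
-- classes of size 1 and q, and the trace of L̄ counts the classes. Since
-- L̄ = n I - J - L and L J = 0, the sum of the squares of the entries of
-- L̄ (L̄ - q) is a combination of n and of the traces of L, L², L³, L⁴; it is
-- therefore a spectral invariant, and it vanishes exactly when the matrix does.
--
-- The traces are recovered from the values χ(x) = det(x - L) at natural numbers
-- x. Let C(x) be the cofactor matrix of x - L, so that x C = C Lᵀ + χ I. Its
-- trace is χ'(x), which is determined by χ(x + h) ≡ χ(x) + h χ'(x) (mod h²) for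
-- all h. Multiplying by powers, x tr(C Lᵉ) = tr(C Lᵉ⁺¹) + χ tr(Lᵉ), while the
-- same equation gives C = O(χ / x). So tr(C Lᵉ) for large x determines tr(Lᵉ),
-- and then tr(C Lᵉ⁺¹).

open import Defs
open import Algebra.Apartness.Bundles using (HeytingField; HeytingCommutativeRing)
open import Algebra.Bundles using (AbelianGroup; CommutativeRing; RawRing)
import Algebra.Definitions.RawMonoid as RawMonoidDefs
import Algebra.Definitions.RawSemiring as RawSemiringDefs
import Algebra.Properties.Group as GroupProperties
import Algebra.Properties.Semiring.Sum as SemiringSum
open import Data.Bool.Base as Bool using (if_then_else_)
open import Data.Empty using (⊥-elim)
open import Data.Fin.Base using (Fin; zero; suc; toℕ; punchIn; lift; punchOut; _↑ˡ_; _↑ʳ_; splitAt; join; combine; cast)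
open import Data.Fin.Patterns using (0F; 1F; 2F; 3F)
import Data.Fin.Properties as Fin
open import Data.Integer.Base using (ℤ; +_; -[1+_]; 0ℤ; 1ℤ; -1ℤ; _+_; _*_; -_; _-_; _⊖_; ∣_∣; +≤+; +-*-rawRing) renaming (_≤_ to _≤ℤ_)
import Data.Integer.Properties as ℤ
open import Data.Integer.Tactic.RingSolver using (solve-∀)
open import Data.List.Base using (length; filter; tabulate)
open import Data.Nat.Base as ℕ using (ℕ; zero; suc; _^_; _≤_; z≤n; s≤s)
open import Data.Nat.Coprimality using (Coprime; coprime-divisor; coprime⇒gcd≡1; gcd≡1⇒coprime)
open import Data.Nat.Divisibility using (_∣_; divides; _∣?_; ∣-trans; ∣1⇒≡1; m∣m*n; ∣m+n∣m⇒∣n)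
open import Data.Nat.DivMod using (_mod_; m≡m%n+[m/n]*n; %-remove-+ˡ; %-remove-+ʳ; m<n⇒m%n≡m; m∣n⇒o%n%m≡o%m)
open import Data.Nat.Primality using (Prime; prime⇒nonZero; prime⇒irreducible; ¬prime[1])
import Data.Nat.Properties as ℕ
open import Data.Nat.Tactic.RingSolver using () renaming (solve-∀ to ℕ-solve-∀)
open import Data.Product.Base using (∃-syntax; _×_; _,_; proj₁; proj₂)
open import Data.Sum.Base using (_⊎_; inj₁; inj₂; [_,_]′)
open import Data.Sum.Properties using (inj₁-injective; inj₂-injective)
open import Data.Unit.Base using (tt)
open import Data.Vec.Functional using (updateAt)
open import Data.Vec.Functional.Properties using (updateAt-updates; updateAt-minimal; updateAt-commutes)
open import Function.Base using (_∘_)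
open import Function.Bundles using (_↔_; mk↔ₛ′; mk⇔)
open import Function.Construct.Identity using (↔-id)
open import Relation.Binary.PropositionalEquality using (_≡_; _≢_; refl; sym; trans; cong; cong₂; cong-app; subst; subst₂; module ≡-Reasoning)
open import Relation.Nullary using (Dec; does; yes; no; ¬_; ¬?)
open import Relation.Nullary.Decidable using (decidable-stable; _×-dec_)
import Relation.Unary as U

-- The field `K` may have undecidable equality and no order, so eigenvalues can be neither compared
-- nor cancelled one by one, and `L` cannot be diagonalised. The list `σ` therefore serves only to
-- equate two characteristic polynomials at natural numbers. Everything else happens over ℤ, where
-- divisibility replaces the coefficients of polynomials, absolute values replace limits, and a
-- vanishing sum of squares replaces the spectral theorem. The equation L̄ (L̄ - q) = 0 leaves open
-- how many classes of each size there are. Trace and vertex count together give a linear equation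
-- for the number of vertices in classes of size q, with coefficient q - 1. It is vacuous for q = 1;
-- the cone is then complete and is treated apart.

module Σℕ = SemiringSum ℕ.+-*-semiring
module ℤ+ = GroupProperties (AbelianGroup.group ℤ.+-0-abelianGroup)
module Σℤ = SemiringSum ℤ.+-*-semiring
open RawSemiringDefs (RawRing.rawSemiring +-*-rawRing) using () renaming (_^_ to _^ℤ_)
module Raw = Determinant +-*-rawRing

-- Determinants over ℤ

-- Opaque, like det below, so that f can be inferred from ∑ f.
opaque
  ∑ : ∀ {n} → (Fin n → ℤ) → ℤ
  ∑ = Σℤ.sum

  ∑-def : ∀ {n} (f : Fin n → ℤ) → Σℤ.sum f ≡ ∑ f
  ∑-def f = refl

  ∑-[] : (f : Fin 0 → ℤ) → ∑ f ≡ 0ℤ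
  ∑-[] f = refl

  ∑-∷ : ∀ {n} (f : Fin (suc n) → ℤ) → ∑ f ≡ f zero + ∑ (λ i → f (suc i))
  ∑-∷ f = refl

  ∑-cong : ∀ {n} {f g : Fin n → ℤ} → (∀ i → f i ≡ g i) → ∑ f ≡ ∑ g
  ∑-cong = Σℤ.sum-cong-≗

  ∑-+ : ∀ {n} (f g : Fin n → ℤ) → ∑ (λ i → f i + g i) ≡ ∑ f + ∑ g
  ∑-+ = Σℤ.∑-distrib-+

  ∑-*ˡ : ∀ {n} c (f : Fin n → ℤ) → ∑ (λ i → c * f i) ≡ c * ∑ f
  ∑-*ˡ c f = sym (Σℤ.*-distribˡ-sum c f)

  ∑-*ʳ : ∀ {n} (f : Fin n → ℤ) c → ∑ (λ i → f i * c) ≡ ∑ f * c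
  ∑-*ʳ f c = sym (Σℤ.*-distribʳ-sum c f)

  ∑-comm : ∀ {m n} (f : Fin m → Fin n → ℤ) → ∑ (λ i → ∑ λ j → f i j) ≡ ∑ (λ j → ∑ λ i → f i j)
  ∑-comm = Σℤ.∑-comm

  ∑-0 : ∀ {n} {f : Fin n → ℤ} → (∀ i → f i ≡ 0ℤ) → ∑ f ≡ 0ℤ
  ∑-0 {n} f≡0 = trans (Σℤ.sum-cong-≗ f≡0) (Σℤ.sum-replicate-zero n)

sgn : ∀ {n} → Fin n → ℤ
sgn j = -1ℤ ^ℤ toℕ j

minor : ∀ {m n} → (Fin (suc m) → Fin (suc n) → ℤ) → Fin (suc n) → Fin m → Fin n → ℤ
minor M j i k = M (suc i) (punchIn j k)

infix 8 _[_≔_]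
_[_≔_] : ∀ {m n} → (Fin m → Fin n → ℤ) → Fin m → (Fin n → ℤ) → (Fin m → Fin n → ℤ)
M [ i ≔ r ] = updateAt M i (λ _ → r)

opaque
  det : ∀ {n} → Matrix ℤ n → ℤ
  det = Raw.det

  det-def : ∀ {n} (M : Matrix ℤ n) → Raw.det M ≡ det M
  det-def M = refl

  det-[] : (M : Matrix ℤ 0) → det M ≡ 1ℤ
  det-[] M = refl

  det-expand : ∀ {n} (M : Matrix ℤ (suc n)) → det M ≡ ∑ λ j → sgn j * (M zero j * det (minor M j))
  det-expand M = ∑-def (λ j → sgn j * (M zero j * Raw.det (minor M j)))

det-cong : ∀ {n} {M N : Matrix ℤ n} → (∀ i j → M i j ≡ N i j) → det M ≡ det N
det-cong {zero}  {M} {N} M≗N = trans (det-[] M) (sym (det-[] N))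
det-cong {suc n} {M} {N} M≗N = trans (det-expand M) (trans
  (∑-cong λ j → cong (sgn j *_) (cong₂ _*_ (M≗N zero j) (det-cong λ i k → M≗N (suc i) (punchIn j k))))
  (sym (det-expand N)))

≔-cong : ∀ {m n} (M : Fin m → Fin n → ℤ) i {r s} → (∀ j → r j ≡ s j) → ∀ a b → (M [ i ≔ r ]) a b ≡ (M [ i ≔ s ]) a b
≔-cong M zero    r≗s zero    b = r≗s b
≔-cong M zero    r≗s (suc a) b = refl
≔-cong M (suc i) r≗s zero    b = refl
≔-cong M (suc i) r≗s (suc a) b = ≔-cong (M ∘ suc) i r≗s a b

≔-same : ∀ {m n} (M : Fin m → Fin n → ℤ) i {r} → (∀ j → M i j ≡ r j) → ∀ a b → (M [ i ≔ r ]) a b ≡ M a b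
≔-same M zero    eq zero    b = sym (eq b)
≔-same M zero    eq (suc a) b = refl
≔-same M (suc i) eq zero    b = refl
≔-same M (suc i) eq (suc a) b = ≔-same (M ∘ suc) i eq a b

minor-≔ : ∀ {m n} (M : Fin (suc m) → Fin (suc n) → ℤ) i r j a b →
  minor (M [ suc i ≔ r ]) j a b ≡ (minor M j [ i ≔ r ∘ punchIn j ]) a b
minor-≔ M zero    r j zero    b = refl
minor-≔ M zero    r j (suc a) b = refl
minor-≔ M (suc i) r j zero    b = refl
minor-≔ M (suc i) r j (suc a) b = minor-≔ (M ∘ suc) i r j a b

det-≔-zero : ∀ {n} (M : Matrix ℤ (suc n)) r →
  det (M [ zero ≔ r ]) ≡ ∑ λ j → sgn j * (r j * det (minor M j))
det-≔-zero M r = det-expand (M [ zero ≔ r ])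

det-≔-suc : ∀ {n} (M : Matrix ℤ (suc n)) i r →
  det (M [ suc i ≔ r ]) ≡ ∑ λ j → sgn j * (M zero j * det (minor M j [ i ≔ r ∘ punchIn j ]))
det-≔-suc M i r = trans (det-expand (M [ suc i ≔ r ]))
  (∑-cong λ j → cong (λ d → sgn j * (M zero j * d)) (det-cong (minor-≔ M i r j)))

det-row-+ : ∀ {n} (M : Matrix ℤ n) i r s → det (M [ i ≔ (λ j → r j + s j) ]) ≡ det (M [ i ≔ r ]) + det (M [ i ≔ s ])
det-row-+ {suc n} M zero r s = begin
  det (M [ zero ≔ (λ j → r j + s j) ])
    ≡⟨ det-≔-zero M (λ j → r j + s j) ⟩
  ∑ (λ j → sgn j * ((r j + s j) * det (minor M j)))
    ≡⟨ (∑-cong λ j → distrib (sgn j) (r j) (s j) (det (minor M j))) ⟩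
  ∑ (λ j → sgn j * (r j * det (minor M j)) + sgn j * (s j * det (minor M j)))
    ≡⟨ ∑-+ _ _ ⟩
  ∑ (λ j → sgn j * (r j * det (minor M j))) + ∑ (λ j → sgn j * (s j * det (minor M j)))
    ≡⟨ cong₂ _+_ (det-≔-zero M r) (det-≔-zero M s) ⟨
  det (M [ zero ≔ r ]) + det (M [ zero ≔ s ]) ∎
  where
  open ≡-Reasoning
  distrib : ∀ ε a b d → ε * ((a + b) * d) ≡ ε * (a * d) + ε * (b * d)
  distrib = solve-∀
det-row-+ {suc n} M (suc i) r s = begin
  det (M [ suc i ≔ (λ j → r j + s j) ])
    ≡⟨ det-≔-suc M i (λ j → r j + s j) ⟩
  ∑ (λ j → sgn j * (M zero j * det (minor M j [ i ≔ (λ k → r (punchIn j k) + s (punchIn j k)) ])))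
    ≡⟨ (∑-cong λ j → trans
         (cong (λ d → sgn j * (M zero j * d)) (det-row-+ (minor M j) i (r ∘ punchIn j) (s ∘ punchIn j)))
         (distrib (sgn j) (M zero j) (D r j) (D s j))) ⟩
  ∑ (λ j → sgn j * (M zero j * D r j) + sgn j * (M zero j * D s j))
    ≡⟨ ∑-+ _ _ ⟩
  ∑ (λ j → sgn j * (M zero j * D r j)) + ∑ (λ j → sgn j * (M zero j * D s j))
    ≡⟨ cong₂ _+_ (det-≔-suc M i r) (det-≔-suc M i s) ⟨
  det (M [ suc i ≔ r ]) + det (M [ suc i ≔ s ]) ∎
  where
  open ≡-Reasoning
  D : (Fin (suc n) → ℤ) → Fin (suc n) → ℤ
  D t j = det (minor M j [ i ≔ t ∘ punchIn j ])
  distrib : ∀ ε a b c → ε * (a * (b + c)) ≡ ε * (a * b) + ε * (a * c)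
  distrib = solve-∀

det-row-* : ∀ {n} (M : Matrix ℤ n) i c r → det (M [ i ≔ (λ j → c * r j) ]) ≡ c * det (M [ i ≔ r ])
det-row-* {suc n} M zero c r = begin
  det (M [ zero ≔ (λ j → c * r j) ])
    ≡⟨ det-≔-zero M (λ j → c * r j) ⟩
  ∑ (λ j → sgn j * (c * r j * det (minor M j)))
    ≡⟨ (∑-cong λ j → assoc (sgn j) c (r j) (det (minor M j))) ⟩
  ∑ (λ j → c * (sgn j * (r j * det (minor M j))))
    ≡⟨ ∑-*ˡ c _ ⟩
  c * ∑ (λ j → sgn j * (r j * det (minor M j)))
    ≡⟨ cong (c *_) (det-≔-zero M r) ⟨
  c * det (M [ zero ≔ r ]) ∎
  where
  open ≡-Reasoning
  assoc : ∀ ε a b d → ε * (a * b * d) ≡ a * (ε * (b * d))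
  assoc = solve-∀
det-row-* {suc n} M (suc i) c r = begin
  det (M [ suc i ≔ (λ j → c * r j) ])
    ≡⟨ det-≔-suc M i (λ j → c * r j) ⟩
  ∑ (λ j → sgn j * (M zero j * det (minor M j [ i ≔ (λ k → c * r (punchIn j k)) ])))
    ≡⟨ (∑-cong λ j → trans
         (cong (λ d → sgn j * (M zero j * d)) (det-row-* (minor M j) i c (r ∘ punchIn j)))
         (assoc (sgn j) (M zero j) c (det (minor M j [ i ≔ r ∘ punchIn j ])))) ⟩
  ∑ (λ j → c * (sgn j * (M zero j * det (minor M j [ i ≔ r ∘ punchIn j ]))))
    ≡⟨ ∑-*ˡ c _ ⟩
  c * ∑ (λ j → sgn j * (M zero j * det (minor M j [ i ≔ r ∘ punchIn j ])))
    ≡⟨ cong (c *_) (det-≔-suc M i r) ⟨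
  c * det (M [ suc i ≔ r ]) ∎
  where
  open ≡-Reasoning
  assoc : ∀ ε a b d → ε * (a * (b * d)) ≡ b * (ε * (a * d))
  assoc = solve-∀

det-row-0 : ∀ {n} (M : Matrix ℤ n) i → det (M [ i ≔ (λ _ → 0ℤ) ]) ≡ 0ℤ
det-row-0 M i = trans (det-row-* M i 0ℤ (λ _ → 0ℤ)) (ℤ.*-zeroˡ (det (M [ i ≔ (λ _ → 0ℤ) ])))

det-row-∑ : ∀ {m n} (M : Matrix ℤ n) i (c : Fin m → ℤ) (r : Fin m → Fin n → ℤ) →
  det (M [ i ≔ (λ j → ∑ λ k → c k * r k j) ]) ≡ ∑ λ k → c k * det (M [ i ≔ r k ])
det-row-∑ {zero}  M i c r = begin
  det (M [ i ≔ (λ j → ∑ λ k → c k * r k j) ]) ≡⟨ det-cong (≔-cong M i λ j → ∑-[] _) ⟩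
  det (M [ i ≔ (λ j → 0ℤ) ])                  ≡⟨ det-row-0 M i ⟩
  0ℤ                                          ≡⟨ ∑-[] _ ⟨
  ∑ (λ k → c k * det (M [ i ≔ r k ]))         ∎
  where open ≡-Reasoning
det-row-∑ {suc m} M i c r = begin
  det (M [ i ≔ (λ j → ∑ λ k → c k * r k j) ])
    ≡⟨ det-cong (≔-cong M i λ j → ∑-∷ _) ⟩
  det (M [ i ≔ (λ j → c zero * r zero j + ∑ λ k → c (suc k) * r (suc k) j) ])
    ≡⟨ det-row-+ M i _ _ ⟩
  det (M [ i ≔ (λ j → c zero * r zero j) ]) + det (M [ i ≔ (λ j → ∑ λ k → c (suc k) * r (suc k) j) ])
    ≡⟨ cong₂ _+_ (det-row-* M i (c zero) (r zero)) (det-row-∑ M i (c ∘ suc) (r ∘ suc)) ⟩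
  c zero * det (M [ i ≔ r zero ]) + ∑ (λ k → c (suc k) * det (M [ i ≔ r (suc k) ]))
    ≡⟨ ∑-∷ _ ⟨
  ∑ (λ k → c k * det (M [ i ≔ r k ])) ∎
  where open ≡-Reasoning

-- If `F j k` belongs to deleting column `j` and then the `k`-th remaining one, `F zero k` and
-- `F (suc k) zero` delete the same two columns in opposite orders. All other pairs leave column 0
-- in place, so an induction can run on them.
∑∑-pair : ∀ {n} (F : Fin (suc (suc n)) → Fin (suc n) → ℤ) →
  ∑ (λ j → ∑ λ k → F j k) ≡ ∑ (λ k → F zero k + F (suc k) zero) + ∑ (λ j → ∑ λ k → F (suc j) (suc k))
∑∑-pair F = begin
  ∑ (λ j → ∑ λ k → F j k)
    ≡⟨ ∑-∷ _ ⟩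
  ∑ (F zero) + ∑ (λ j → ∑ λ k → F (suc j) k)
    ≡⟨ cong (λ z → ∑ (F zero) + z) (trans (∑-cong λ j → ∑-∷ (F (suc j))) (∑-+ _ _)) ⟩
  ∑ (F zero) + (∑ (λ j → F (suc j) zero) + ∑ (λ j → ∑ λ k → F (suc j) (suc k)))
    ≡⟨ ℤ.+-assoc (∑ (F zero)) _ _ ⟨
  ∑ (F zero) + ∑ (λ j → F (suc j) zero) + ∑ (λ j → ∑ λ k → F (suc j) (suc k))
    ≡⟨ cong (_+ ∑ (λ j → ∑ λ k → F (suc j) (suc k))) (∑-+ (F zero) (λ j → F (suc j) zero)) ⟨
  ∑ (λ k → F zero k + F (suc k) zero) + ∑ (λ j → ∑ λ k → F (suc j) (suc k)) ∎
  where open ≡-Reasoning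

-- Deleting two columns in either order leaves the same matrix with opposite
-- signs, so the double expansion along two equal rows cancels in pairs.
alternating-sum : ∀ {n} (a : Fin (suc (suc n)) → ℤ) (Φ : (Fin n → Fin (suc (suc n))) → ℤ) →
  (∀ {f g} → (∀ c → f c ≡ g c) → Φ f ≡ Φ g) →
  ∑ (λ j → ∑ λ k → sgn j * (a j * (sgn k * (a (punchIn j k) * Φ λ c → punchIn j (punchIn k c))))) ≡ 0ℤ
alternating-sum {n} a Φ Φ-cong = trans (∑∑-pair F) (cong₂ _+_ (∑-0 pair) (rest n a Φ Φ-cong))
  where
  F : Fin (suc (suc n)) → Fin (suc n) → ℤ
  F j k = sgn j * (a j * (sgn k * (a (punchIn j k) * Φ λ c → punchIn j (punchIn k c))))

  cancel : ∀ x s y p → 1ℤ * (x * (s * (y * p))) + -1ℤ * s * (y * (1ℤ * (x * p))) ≡ 0ℤ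
  cancel = solve-∀

  pair : ∀ k → F zero k + F (suc k) zero ≡ 0ℤ
  pair k = cancel (a zero) (sgn k) (a (suc k)) (Φ λ c → suc (punchIn k c))

  signs : ∀ s x t y p → -1ℤ * s * (x * (-1ℤ * t * (y * p))) ≡ s * (x * (t * (y * p)))
  signs = solve-∀

  rest : ∀ n (a : Fin (suc (suc n)) → ℤ) (Φ : (Fin n → Fin (suc (suc n))) → ℤ) →
    (∀ {f g} → (∀ c → f c ≡ g c) → Φ f ≡ Φ g) →
    ∑ (λ j → ∑ λ k → sgn (suc j) * (a (suc j) * (sgn (suc k) * (a (punchIn (suc j) (suc k)) * Φ λ c → punchIn (suc j) (punchIn (suc k) c))))) ≡ 0ℤ
  rest zero    a Φ Φ-cong = ∑-0 λ j → ∑-[] _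
  rest (suc n) a Φ Φ-cong = trans
    (∑-cong λ j → ∑-cong λ k → trans
      (signs (sgn j) (a (suc j)) (sgn k) (a (suc (punchIn j k))) _)
      (cong (λ p → sgn j * (a (suc j) * (sgn k * (a (suc (punchIn j k)) * p))))
        (Φ-cong λ { zero → refl ; (suc c) → refl })))
    -- Each remaining selection keeps column 0, hence is a selection of the later columns extended
    -- by `lift 1`.
    (alternating-sum (a ∘ suc) (Φ ∘ lift 1) λ f≗g → Φ-cong λ { zero → refl ; (suc c) → cong suc (f≗g c) })

det-rows-0≗1 : ∀ {n} (M : Matrix ℤ (suc (suc n))) → (∀ j → M zero j ≡ M (suc zero) j) → det M ≡ 0ℤ
det-rows-0≗1 M eq = begin
  det M
    ≡⟨ det-expand M ⟩
  ∑ (λ j → sgn j * (M zero j * det (minor M j)))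
    ≡⟨ (∑-cong λ j → trans
         (cong (λ d → sgn j * (M zero j * d)) (trans (det-expand (minor M j))
           (∑-cong λ k → cong (λ b → sgn k * (b * det (minor (minor M j) k))) (sym (eq (punchIn j k))))))
         (trans (sym (ℤ.*-assoc (sgn j) (M zero j) _)) (trans (sym (∑-*ˡ (sgn j * M zero j) _))
           (∑-cong λ k → ℤ.*-assoc (sgn j) (M zero j) (sgn k * (M zero (punchIn j k) * det (minor (minor M j) k))))))) ⟩
  ∑ (λ j → ∑ λ k → sgn j * (M zero j * (sgn k * (M zero (punchIn j k) * det (minor (minor M j) k)))))
    ≡⟨ alternating-sum (M zero) (λ f → det λ i c → M (suc (suc i)) (f c))
         (λ f≗g → det-cong λ i c → cong (M (suc (suc i))) (f≗g c)) ⟩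
  0ℤ ∎
  where open ≡-Reasoning

-- Polarisation: with `r + s` in both rows the determinant vanishes, and so do the two pure terms of
-- its expansion, leaving the mixed ones. `alt` is assumed for the two given rows only, so that the
-- lemma is available before alternation is known for all rows.
det-swap : ∀ {n} (M : Matrix ℤ n) {i k} → i ≢ k →
  (∀ N → (∀ j → N i j ≡ N k j) → det N ≡ 0ℤ) →
  ∀ r s → det ((M [ i ≔ r ]) [ k ≔ s ]) ≡ - det ((M [ i ≔ s ]) [ k ≔ r ])
det-swap {n} M {i} {k} i≢k alt r s = negate (f r s) (f s r) (begin
  f r s + f s r
    ≡⟨ pad (f r s) (f s r) ⟩
  (0ℤ + f r s) + (f s r + 0ℤ)
    ≡⟨ cong₂ (λ a b → (a + f r s) + (f s r + b)) (f-alt r) (f-alt s) ⟨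
  (f r r + f r s) + (f s r + f s s)
    ≡⟨ cong₂ _+_ (det-row-+ (M [ i ≔ r ]) k r s) (det-row-+ (M [ i ≔ s ]) k r s) ⟨
  f r t + f s t
    ≡⟨ f-+ ⟨
  f t t
    ≡⟨ f-alt t ⟩
  0ℤ ∎)
  where
  open ≡-Reasoning
  t : Fin n → ℤ
  t j = r j + s j
  f : (Fin n → ℤ) → (Fin n → ℤ) → ℤ
  f a b = det ((M [ i ≔ a ]) [ k ≔ b ])
  pad : ∀ a b → a + b ≡ (0ℤ + a) + (b + 0ℤ)
  pad = solve-∀
  negate : ∀ a b → a + b ≡ 0ℤ → a ≡ - b
  negate a b eq = trans (shift a b) (trans (cong (_+ - b) eq) (ℤ.+-identityˡ (- b)))
    where
    shift : ∀ a b → a ≡ a + b + - b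
    shift = solve-∀
  f-alt : ∀ a → f a a ≡ 0ℤ
  f-alt a = alt _ λ j → cong-app (trans
    (trans (updateAt-minimal i k (M [ i ≔ a ]) i≢k) (updateAt-updates i M))
    (sym (updateAt-updates k (M [ i ≔ a ])))) j
  commute : ∀ a b → f a b ≡ det ((M [ k ≔ b ]) [ i ≔ a ])
  commute a b = det-cong λ x → cong-app (updateAt-commutes k i (i≢k ∘ sym) M x)
  f-+ : f t t ≡ f r t + f s t
  f-+ = trans (commute t t) (trans (det-row-+ (M [ k ≔ t ]) i r s) (sym (cong₂ _+_ (commute r t) (commute s t))))

det-equal-rows : ∀ {n} (M : Matrix ℤ n) {i k} → i ≢ k → (∀ j → M i j ≡ M k j) → det M ≡ 0ℤ
-- Rows 0 and 1 are settled by the double expansion. A later row is first exchanged with row 1; that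
-- swap avoids row 0, so the alternation it requires comes from the smaller minors.
det-equal-rows-0 : ∀ {n} (M : Matrix ℤ (suc n)) {k} → (∀ j → M zero j ≡ M (suc k) j) → det M ≡ 0ℤ
det-equal-rows-suc : ∀ {n} (M : Matrix ℤ (suc n)) {i k} → i ≢ k → (∀ j → M (suc i) j ≡ M (suc k) j) → det M ≡ 0ℤ

det-equal-rows M {zero}  {zero}  i≢k eq = ⊥-elim (i≢k refl)
det-equal-rows M {zero}  {suc k} i≢k eq = det-equal-rows-0 M eq
det-equal-rows M {suc i} {zero}  i≢k eq = det-equal-rows-0 M (λ j → sym (eq j))
det-equal-rows M {suc i} {suc k} i≢k eq = det-equal-rows-suc M (i≢k ∘ cong suc) eq

det-equal-rows-0 M {zero}  eq = det-rows-0≗1 M eq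
det-equal-rows-0 M {suc k} eq = begin
  det M
    ≡⟨ det-cong (λ a b → trans
         (≔-same (M [ 1F ≔ M 1F ]) k′ (≔-same M 1F (λ _ → refl) k′) a b)
         (≔-same M 1F (λ _ → refl) a b)) ⟨
  det ((M [ 1F ≔ M 1F ]) [ k′ ≔ M k′ ])
    ≡⟨ det-swap M (λ ()) (λ N → det-equal-rows-suc N (λ ())) (M 1F) (M k′) ⟩
  - det ((M [ 1F ≔ M k′ ]) [ k′ ≔ M 1F ])
    ≡⟨ cong -_ (det-rows-0≗1 ((M [ 1F ≔ M k′ ]) [ k′ ≔ M 1F ]) eq) ⟩
  0ℤ ∎
  where
  open ≡-Reasoning
  k′ = suc (suc k)

det-equal-rows-suc M {i} {k} i≢k eq = trans (det-expand M) (∑-0 λ j → trans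
  (cong (λ d → sgn j * (M zero j * d)) (det-equal-rows (minor M j) i≢k λ c → eq (punchIn j c)))
  (zeros (sgn j) (M zero j)))
  where
  zeros : ∀ s a → s * (a * 0ℤ) ≡ 0ℤ
  zeros = solve-∀

-- Jacobi's formula as a congruence modulo `h * h`, by the product rule along the first row. Only
-- the divisibility of the remainder matters, so `r` stays existential.
det-derivative : ∀ {n} (M N : Matrix ℤ n) h → ∃[ r ]
  det (λ i j → M i j + h * N i j) ≡ det M + h * ∑ (λ i → det (M [ i ≔ N i ])) + h * h * r
det-derivative {zero} M N h = 0ℤ , trans (det-cong {N = M} λ ()) (trans (pad (det M) h)
  (cong (λ s → det M + h * s + h * h * 0ℤ) (sym (∑-[] _))))
  where
  pad : ∀ a h → a ≡ a + h * 0ℤ + h * h * 0ℤ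
  pad = solve-∀
det-derivative {suc n} M N h = ∑ R , (begin
  det (λ i j → M i j + h * N i j)
    ≡⟨ det-expand _ ⟩
  ∑ (λ j → s j * ((m j + h * N zero j) * det (λ i c → minor M j i c + h * minor N j i c)))
    ≡⟨ (∑-cong λ j → trans
         (cong (λ d → s j * ((m j + h * N zero j) * d)) (proj₂ (det-derivative (minor M j) (minor N j) h)))
         (expand (s j) (m j) h (N zero j) (d j) (t j) (r j))) ⟩
  ∑ (λ j → s j * (m j * d j) + h * (s j * (N zero j * d j) + s j * (m j * t j)) + h * h * R j)
    ≡⟨ trans (∑-+ _ _) (cong₂ _+_ (trans (∑-+ _ _) (cong (λ z → ∑ (λ j → s j * (m j * d j)) + z) (∑-*ˡ h _))) (∑-*ˡ (h * h) R)) ⟩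
  ∑ (λ j → s j * (m j * d j)) + h * ∑ (λ j → s j * (N zero j * d j) + s j * (m j * t j)) + h * h * ∑ R
    ≡⟨ cong₂ (λ a b → a + h * b + h * h * ∑ R) (det-expand M) trace ⟨
  det M + h * ∑ (λ i → det (M [ i ≔ N i ])) + h * h * ∑ R ∎)
  where
  open ≡-Reasoning
  s m d t r R : Fin (suc n) → ℤ
  s = sgn
  m = M zero
  d j = det (minor M j)
  t j = ∑ λ i → det (minor M j [ i ≔ minor N j i ])
  r j = proj₁ (det-derivative (minor M j) (minor N j) h)
  R j = s j * (m j * r j + N zero j * t j + h * (N zero j * r j))

  expand : ∀ s m h n d t r → s * ((m + h * n) * (d + h * t + h * h * r)) ≡
    s * (m * d) + h * (s * (n * d) + s * (m * t)) + h * h * (s * (m * r + n * t + h * (n * r)))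
  expand = solve-∀

  trace : ∑ (λ i → det (M [ i ≔ N i ])) ≡ ∑ (λ j → s j * (N zero j * d j) + s j * (m j * t j))
  trace = begin
    ∑ (λ i → det (M [ i ≔ N i ]))
      ≡⟨ ∑-∷ _ ⟩
    det (M [ zero ≔ N zero ]) + ∑ (λ i → det (M [ suc i ≔ N (suc i) ]))
      ≡⟨ cong₂ _+_ (det-≔-zero M (N zero)) (trans (∑-cong λ i → det-≔-suc M i (N (suc i))) (∑-comm _)) ⟩
    ∑ (λ j → s j * (N zero j * d j)) + ∑ (λ j → ∑ λ i → s j * (m j * det (minor M j [ i ≔ minor N j i ])))
      ≡⟨ cong (λ z → ∑ (λ j → s j * (N zero j * d j)) + z) (∑-cong λ j → trans (∑-*ˡ (s j) _) (cong (s j *_) (∑-*ˡ (m j) _))) ⟩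
    ∑ (λ j → s j * (N zero j * d j)) + ∑ (λ j → s j * (m j * t j))
      ≡⟨ ∑-+ _ _ ⟨
    ∑ (λ j → s j * (N zero j * d j) + s j * (m j * t j)) ∎

-- Power traces from the characteristic polynomial

δ : ∀ {n} → Matrix ℤ n
δ i j = if does (i Fin.≟ j) then 1ℤ else 0ℤ

δ-refl : ∀ {n} (i : Fin n) → δ i i ≡ 1ℤ
δ-refl zero    = refl
δ-refl (suc i) = δ-refl i

δ-≢ : ∀ {n} {i j : Fin n} → i ≢ j → δ i j ≡ 0ℤ
δ-≢ {i = i} {j} i≢j with i Fin.≟ j
... | yes i≡j = ⊥-elim (i≢j i≡j)
... | no  _   = refl

δ-sym : ∀ {n} (i j : Fin n) → δ i j ≡ δ j i
δ-sym i j with i Fin.≟ j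
... | yes refl = sym (δ-refl i)
... | no  i≢j  = sym (δ-≢ (i≢j ∘ sym))

∑-δ : ∀ {n} (i : Fin n) (f : Fin n → ℤ) → ∑ (λ j → δ i j * f j) ≡ f i
∑-δ zero    f = trans (∑-∷ _) (trans
  (cong₂ _+_ (ℤ.*-identityˡ (f zero)) (∑-0 λ j → ℤ.*-zeroˡ (f (suc j))))
  (ℤ.+-identityʳ (f zero)))
∑-δ (suc i) f = trans (∑-∷ _) (trans
  (cong₂ _+_ (ℤ.*-zeroˡ (f zero)) (∑-δ i (f ∘ suc)))
  (ℤ.+-identityˡ (f (suc i))))

tr : ∀ {n} → Matrix ℤ n → ℤ
tr M = ∑ λ i → M i i

-- Lᵀ rather than L, because cofactors of a row are expanded against its entries.
pow : ∀ {n} → Matrix ℤ n → ℕ → Matrix ℤ n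
pow L zero        = δ
pow L (suc e) l i = ∑ λ k → L k l * pow L e k i

module Resolvent {n} (L : Matrix ℤ n) (x : ℤ) where

  shifted : Matrix ℤ n
  shifted i j = x * δ i j - L i j

  χ : ℤ
  χ = det shifted

  -- Entry `(l , i)` of the adjugate of `shifted`. As a determinant with a replaced row it needs no
  -- signed minors, and the adjugate identity becomes linearity in that row.
  cofactor : Matrix ℤ n
  cofactor i l = det (shifted [ i ≔ δ l ])

  det-≔-row : ∀ i k → det (shifted [ i ≔ shifted k ]) ≡ δ i k * χ
  det-≔-row i k with i Fin.≟ k
  ... | yes refl = trans (det-cong (≔-same shifted i λ _ → refl)) (sym (ℤ.*-identityˡ χ))
  ... | no  i≢k  = trans
    (det-equal-rows (shifted [ i ≔ shifted k ]) i≢k (cong-app (trans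
      (updateAt-updates i shifted) (sym (updateAt-minimal k i shifted (i≢k ∘ sym))))))
    (sym (ℤ.*-zeroˡ χ))

  -- The vector `x * δ k` is row `k` of `L` plus row `k` of `shifted`. Put into row `i`, the first
  -- summand gives the cofactors and the second a repeated row, unless `i` is `k`.
  cofactor-row : ∀ i k → x * cofactor i k ≡ ∑ (λ l → L k l * cofactor i l) + δ i k * χ
  cofactor-row i k = begin
    x * cofactor i k
      ≡⟨ det-row-* shifted i x (δ k) ⟨
    det (shifted [ i ≔ (λ j → x * δ k j) ])
      ≡⟨ det-cong (≔-cong shifted i λ j → trans (split (x * δ k j) (L k j))
           (cong (_+ shifted k j) (sym (trans (∑-cong λ l → trans (ℤ.*-comm (L k l) (δ l j)) (cong (_* L k l) (δ-sym l j))) (∑-δ j (L k)))))) ⟩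
    det (shifted [ i ≔ (λ j → ∑ (λ l → L k l * δ l j) + shifted k j) ])
      ≡⟨ det-row-+ shifted i (λ j → ∑ (λ l → L k l * δ l j)) (shifted k) ⟩
    det (shifted [ i ≔ (λ j → ∑ (λ l → L k l * δ l j)) ]) + det (shifted [ i ≔ shifted k ])
      ≡⟨ cong₂ _+_ (det-row-∑ shifted i (L k) δ) (det-≔-row i k) ⟩
    ∑ (λ l → L k l * cofactor i l) + δ i k * χ ∎
    where
    open ≡-Reasoning
    split : ∀ a b → a ≡ b + (a - b)
    split = solve-∀

  -- Where `χ` is non-zero, this is `χ` times the trace of Lᵉ (x - L)⁻¹; the factor `χ` keeps it
  -- integral.
  moment : ℕ → ℤ
  moment e = ∑ λ i → ∑ λ k → cofactor i k * pow L e k i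

  moment-0 : moment 0 ≡ ∑ λ i → det (shifted [ i ≔ δ i ])
  moment-0 = ∑-cong λ i → trans
    (∑-cong λ k → trans (ℤ.*-comm (cofactor i k) (δ k i)) (cong (_* cofactor i k) (δ-sym k i)))
    (∑-δ i (cofactor i))

  moment-suc : ∀ e → x * moment e ≡ moment (suc e) + χ * tr (pow L e)
  moment-suc e = begin
    x * moment e
      ≡⟨ trans (sym (∑-*ˡ x _)) (∑-cong row) ⟩
    ∑ (λ i → ∑ (λ l → cofactor i l * pow L (suc e) l i) + χ * P i i)
      ≡⟨ trans (∑-+ _ _) (cong (λ z → moment (suc e) + z) (∑-*ˡ χ λ i → P i i)) ⟩
    moment (suc e) + χ * tr P ∎
    where
    open ≡-Reasoning
    P = pow L e
    distrib : ∀ a b c d → (a + b * c) * d ≡ a * d + b * (c * d)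
    distrib = solve-∀
    swap : ∀ a b c → a * b * c ≡ b * (a * c)
    swap = solve-∀
    row : ∀ i → x * ∑ (λ k → cofactor i k * P k i) ≡ ∑ (λ l → cofactor i l * pow L (suc e) l i) + χ * P i i
    row i = begin
      x * ∑ (λ k → cofactor i k * P k i)
        ≡⟨ ∑-*ˡ x _ ⟨
      ∑ (λ k → x * (cofactor i k * P k i))
        ≡⟨ (∑-cong λ k → trans (sym (ℤ.*-assoc x (cofactor i k) (P k i))) (trans
             (cong (_* P k i) (cofactor-row i k))
             (distrib (∑ λ l → L k l * cofactor i l) (δ i k) χ (P k i)))) ⟩
      ∑ (λ k → ∑ (λ l → L k l * cofactor i l) * P k i + δ i k * (χ * P k i))
        ≡⟨ trans (∑-+ _ _) (cong₂ _+_
             (trans (∑-cong λ k → trans (sym (∑-*ʳ _ (P k i))) (∑-cong λ l → swap (L k l) (cofactor i l) (P k i))) (∑-comm _))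
             (∑-δ i λ k → χ * P k i)) ⟩
      ∑ (λ l → ∑ (λ k → cofactor i l * (L k l * P k i))) + χ * P i i
        ≡⟨ cong (_+ χ * P i i) (∑-cong λ l → ∑-*ˡ (cofactor i l) _) ⟩
      ∑ (λ l → cofactor i l * pow L (suc e) l i) + χ * P i i ∎

χ-derivative : ∀ {n} (L : Matrix ℤ n) x h → ∃[ r ]
  Resolvent.χ L (x + h) ≡ Resolvent.χ L x + h * Resolvent.moment L x 0 + h * h * r
χ-derivative L x h with r , eq ← det-derivative (Resolvent.shifted L x) δ h = r , trans
  (det-cong λ i j → shift x h (δ i j) (L i j))
  (trans eq (cong (λ m → χ + h * m + h * h * r) (sym moment-0)))
  where
  open Resolvent L x
  shift : ∀ x h d l → (x + h) * d - l ≡ x * d - l + h * d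
  shift = solve-∀

i≡[1+∣i∣]*r⇒i≡0 : ∀ i (r : ℤ) → i ≡ + suc ∣ i ∣ * r → i ≡ 0ℤ
i≡[1+∣i∣]*r⇒i≡0 i r eq with ∣ r ∣ in ∣r∣≡ | trans (cong ∣_∣ eq) (ℤ.abs-* (+ suc ∣ i ∣) r)
... | zero  | ∣i∣≡ = ℤ.∣i∣≡0⇒i≡0 (trans ∣i∣≡ (ℕ.*-zeroʳ ∣ i ∣))
... | suc m | ∣i∣≡ = ⊥-elim (ℕ.<-irrefl refl (ℕ.≤-trans (ℕ.m≤m*n (suc ∣ i ∣) (suc m)) (ℕ.≤-reflexive (sym ∣i∣≡))))

-- Comparing the two expansions shows that every non-zero `h` divides the difference `d` of the
-- derivatives. The choice `h = 1 + ∣ d ∣` exceeds `d` in absolute value and forces `d` to be zero.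
moment-0-unique : ∀ {m n} (L : Matrix ℤ m) (L′ : Matrix ℤ n) →
  (∀ x → Resolvent.χ L (+ x) ≡ Resolvent.χ L′ (+ x)) →
  ∀ x → Resolvent.moment L (+ x) 0 ≡ Resolvent.moment L′ (+ x) 0
moment-0-unique L L′ χ≡χ′ x
  with d ← Resolvent.moment L (+ x) 0 - Resolvent.moment L′ (+ x) 0 in d≡
  with r  , eq  ← χ-derivative L  (+ x) (+ suc ∣ d ∣)
     | r′ , eq′ ← χ-derivative L′ (+ x) (+ suc ∣ d ∣)
  = ℤ.i-j≡0⇒i≡j _ _ (trans d≡ (i≡[1+∣i∣]*r⇒i≡0 d (r′ - r) (ℤ.*-cancelˡ-≡ h d (h * (r′ - r)) (begin
    h * d                                   ≡⟨ cong (h *_) d≡ ⟨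
    h * (M - M′)                            ≡⟨ ℤ.i-j≡0⇒i≡j _ _ (trans (rearrange c h M M′ r r′) (ℤ.i≡j⇒i-j≡0 both)) ⟩
    h * (h * (r′ - r))                      ∎))))
  where
  open ≡-Reasoning
  h = + suc ∣ d ∣
  M = Resolvent.moment L (+ x) 0
  M′ = Resolvent.moment L′ (+ x) 0
  c = Resolvent.χ L (+ x)
  both : c + h * M + h * h * r ≡ c + h * M′ + h * h * r′
  both = trans (sym eq) (trans (χ≡χ′ (x ℕ.+ suc ∣ d ∣)) (trans eq′ (cong (λ c → c + h * M′ + h * h * r′) (sym (χ≡χ′ x)))))
  rearrange : ∀ c h m m′ r r′ → h * (m - m′) - h * (h * (r′ - r)) ≡ (c + h * m + h * h * r) - (c + h * m′ + h * h * r′)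
  rearrange = solve-∀

-- Estimates for cofactors and moments at large arguments

opaque
  ∑ℕ : ∀ {n} → (Fin n → ℕ) → ℕ
  ∑ℕ = Σℕ.sum

  ∑ℕ-∷ : ∀ {n} (f : Fin (suc n) → ℕ) → ∑ℕ f ≡ f zero ℕ.+ ∑ℕ (λ i → f (suc i))
  ∑ℕ-∷ f = refl

  ∑ℕ-+ : ∀ {n} (f g : Fin n → ℕ) → ∑ℕ (λ i → f i ℕ.+ g i) ≡ ∑ℕ f ℕ.+ ∑ℕ g
  ∑ℕ-+ = Σℕ.∑-distrib-+

  ∑ℕ-*ˡ : ∀ {n} c (f : Fin n → ℕ) → ∑ℕ (λ i → c ℕ.* f i) ≡ c ℕ.* ∑ℕ f
  ∑ℕ-*ˡ c f = sym (Σℕ.*-distribˡ-sum c f)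

  ∑ℕ-*ʳ : ∀ {n} (f : Fin n → ℕ) c → ∑ℕ (λ i → f i ℕ.* c) ≡ ∑ℕ f ℕ.* c
  ∑ℕ-*ʳ f c = sym (Σℕ.*-distribʳ-sum c f)

  ∑ℕ-const : ∀ n c → ∑ℕ {n} (λ _ → c) ≡ n ℕ.* c
  ∑ℕ-const zero    c = refl
  ∑ℕ-const (suc n) c = cong (c ℕ.+_) (∑ℕ-const n c)

  ∑ℕ-mono : ∀ {n} {f g : Fin n → ℕ} → (∀ i → f i ≤ g i) → ∑ℕ f ≤ ∑ℕ g
  ∑ℕ-mono {zero}  f≤g = z≤n
  ∑ℕ-mono {suc n} f≤g = ℕ.+-mono-≤ (f≤g zero) (∑ℕ-mono (f≤g ∘ suc))

  ∑ℕ-≥ : ∀ {n} (f : Fin n → ℕ) i → f i ≤ ∑ℕ f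
  ∑ℕ-≥ f zero    = ℕ.m≤m+n (f zero) _
  ∑ℕ-≥ f (suc i) = ℕ.≤-trans (∑ℕ-≥ (f ∘ suc) i) (ℕ.m≤n+m _ (f zero))

  ∣∑∣≤ : ∀ {n} (f : Fin n → ℤ) → ∣ ∑ f ∣ ≤ ∑ℕ (λ i → ∣ f i ∣)
  ∣∑∣≤ {zero}  f = subst (λ s → ∣ s ∣ ≤ 0) (sym (∑-[] f)) z≤n
  ∣∑∣≤ {suc n} f = subst (λ s → ∣ s ∣ ≤ ∑ℕ (λ i → ∣ f i ∣)) (sym (∑-∷ f))
    (ℕ.≤-trans (ℤ.∣i+j∣≤∣i∣+∣j∣ (f zero) _) (ℕ.+-monoʳ-≤ ∣ f zero ∣ (∣∑∣≤ (f ∘ suc))))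

‖_‖ : ∀ {n} → Matrix ℤ n → ℕ
‖ M ‖ = ∑ℕ λ i → ∑ℕ λ j → ∣ M i j ∣

∣δ∣≤1 : ∀ {n} (i j : Fin n) → ∣ δ i j ∣ ≤ 1
∣δ∣≤1 i j with i Fin.≟ j
... | yes _ = s≤s z≤n
... | no  _ = z≤n

∣∑*∣≤ : ∀ {n} (f g : Fin n → ℤ) → ∣ ∑ (λ i → f i * g i) ∣ ≤ ∑ℕ (λ i → ∣ f i ∣ ℕ.* ∣ g i ∣)
∣∑*∣≤ f g = ℕ.≤-trans (∣∑∣≤ λ i → f i * g i) (∑ℕ-mono λ i → ℕ.≤-reflexive (ℤ.abs-* (f i) (g i)))

-- Writing the argument as `c + y` makes its excess over a bound for the norm a natural number, so
-- the estimates involve neither division nor subtraction.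
module Bounds {n} (L : Matrix ℤ n) (c y : ℕ) (‖L‖≤c : ‖ L ‖ ≤ c) where
  open Resolvent L (+ (c ℕ.+ y))
  open ℕ.≤-Reasoning

  rowNorm : Fin n → ℕ
  rowNorm i = ∑ℕ λ k → ∣ cofactor i k ∣

  -- Sum the absolute values of x C = C Lᵀ + χ I along a row, with x = c + y.
  cofactor-bound : ∀ i → y ℕ.* rowNorm i ≤ n ℕ.* ∣ χ ∣
  cofactor-bound i = ℕ.+-cancelˡ-≤ (c ℕ.* s) _ _ (begin
    c ℕ.* s ℕ.+ y ℕ.* s                       ≡⟨ ℕ.*-distribʳ-+ s c y ⟨
    (c ℕ.+ y) ℕ.* s                           ≡⟨ ∑ℕ-*ˡ (c ℕ.+ y) _ ⟨
    ∑ℕ (λ k → (c ℕ.+ y) ℕ.* ∣ cofactor i k ∣) ≤⟨ ∑ℕ-mono entry ⟩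
    ∑ℕ (λ k → w k ℕ.* s ℕ.+ ∣ χ ∣)            ≡⟨ ∑ℕ-+ (λ k → w k ℕ.* s) (λ _ → ∣ χ ∣) ⟩
    ∑ℕ (λ k → w k ℕ.* s) ℕ.+ ∑ℕ {n} (λ _ → ∣ χ ∣) ≡⟨ cong₂ ℕ._+_ (∑ℕ-*ʳ w s) (∑ℕ-const n ∣ χ ∣) ⟩
    ‖ L ‖ ℕ.* s ℕ.+ n ℕ.* ∣ χ ∣               ≤⟨ ℕ.+-monoˡ-≤ (n ℕ.* ∣ χ ∣) (ℕ.*-monoˡ-≤ s ‖L‖≤c) ⟩
    c ℕ.* s ℕ.+ n ℕ.* ∣ χ ∣                   ∎)
    where
    s = rowNorm i
    w : Fin n → ℕ
    w k = ∑ℕ λ l → ∣ L k l ∣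
    entry : ∀ k → (c ℕ.+ y) ℕ.* ∣ cofactor i k ∣ ≤ w k ℕ.* s ℕ.+ ∣ χ ∣
    entry k = begin
      (c ℕ.+ y) ℕ.* ∣ cofactor i k ∣
        ≡⟨ ℤ.abs-* (+ (c ℕ.+ y)) (cofactor i k) ⟨
      ∣ + (c ℕ.+ y) * cofactor i k ∣
        ≡⟨ cong ∣_∣ (cofactor-row i k) ⟩
      ∣ ∑ (λ l → L k l * cofactor i l) + δ i k * χ ∣
        ≤⟨ ℤ.∣i+j∣≤∣i∣+∣j∣ (∑ λ l → L k l * cofactor i l) (δ i k * χ) ⟩
      ∣ ∑ (λ l → L k l * cofactor i l) ∣ ℕ.+ ∣ δ i k * χ ∣
        ≤⟨ ℕ.+-mono-≤
             (ℕ.≤-trans (∣∑*∣≤ (L k) (cofactor i)) (∑ℕ-mono λ l → ℕ.*-monoʳ-≤ ∣ L k l ∣ (∑ℕ-≥ (λ l → ∣ cofactor i l ∣) l)))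
             (ℕ.≤-trans (ℕ.≤-reflexive (ℤ.abs-* (δ i k) χ)) (ℕ.*-monoˡ-≤ ∣ χ ∣ (∣δ∣≤1 i k))) ⟩
      ∑ℕ (λ l → ∣ L k l ∣ ℕ.* s) ℕ.+ 1 ℕ.* ∣ χ ∣
        ≡⟨ cong₂ ℕ._+_ (∑ℕ-*ʳ (λ l → ∣ L k l ∣) s) (ℕ.*-identityˡ ∣ χ ∣) ⟩
      w k ℕ.* s ℕ.+ ∣ χ ∣ ∎

  -- The coefficient of `∣ χ ∣` on the right does not involve `y`, so relative to `χ` the moment
  -- decays like 1 / y.
  moment-bound : ∀ e → y ℕ.* ∣ moment e ∣ ≤ n ℕ.* ∣ χ ∣ ℕ.* ‖ (λ i k → pow L e k i) ‖
  moment-bound e = begin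
    y ℕ.* ∣ moment e ∣
      ≤⟨ ℕ.*-monoʳ-≤ y (ℕ.≤-trans (∣∑∣≤ λ i → ∑ λ k → cofactor i k * pow L e k i) (∑ℕ-mono λ i →
           ℕ.≤-trans (∣∑*∣≤ (cofactor i) (λ k → pow L e k i)) (ℕ.≤-trans
             (∑ℕ-mono λ k → ℕ.*-monoˡ-≤ ∣ pow L e k i ∣ (∑ℕ-≥ (λ k → ∣ cofactor i k ∣) k))
             (ℕ.≤-reflexive (∑ℕ-*ˡ (rowNorm i) λ k → ∣ pow L e k i ∣))))) ⟩
    y ℕ.* ∑ℕ (λ i → rowNorm i ℕ.* P i)
      ≡⟨ ∑ℕ-*ˡ y _ ⟨
    ∑ℕ (λ i → y ℕ.* (rowNorm i ℕ.* P i))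
      ≤⟨ (∑ℕ-mono λ i → ℕ.≤-trans (ℕ.≤-reflexive (sym (ℕ.*-assoc y (rowNorm i) (P i))))
           (ℕ.*-monoˡ-≤ (P i) (cofactor-bound i))) ⟩
    ∑ℕ (λ i → n ℕ.* ∣ χ ∣ ℕ.* P i)
      ≡⟨ ∑ℕ-*ˡ (n ℕ.* ∣ χ ∣) P ⟩
    n ℕ.* ∣ χ ∣ ℕ.* ∑ℕ P ∎
    where
    P : Fin n → ℕ
    P i = ∑ℕ λ k → ∣ pow L e k i ∣

-- If `χ` vanished, `cofactor-bound` would annihilate every cofactor. But the one at `(zero , zero)`
-- is the same determinant for the matrix without its first row and column, so descent ends at the
-- empty determinant 1.
χ≢0 : ∀ {n} (L : Matrix ℤ n) c y → ‖ L ‖ ≤ c → Resolvent.χ L (+ (c ℕ.+ suc y)) ≢ 0ℤ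
χ≢0 {zero}  L c y ‖L‖≤c χ≡0 with () ← trans (sym χ≡0) (det-[] (Resolvent.shifted L (+ (c ℕ.+ suc y))))
χ≢0 {suc n} L c y ‖L‖≤c χ≡0 = χ≢0 L₀₀ c y (ℕ.≤-trans ‖L₀₀‖≤‖L‖ ‖L‖≤c) (trans (sym cofactor₀₀) (ℤ.∣i∣≡0⇒i≡0 ∣C∣≡0))
  where
  open Resolvent L (+ (c ℕ.+ suc y))
  open Bounds L c (suc y) ‖L‖≤c using (cofactor-bound; rowNorm)

  L₀₀ : Matrix ℤ n
  L₀₀ i j = L (suc i) (suc j)

  ∑ℕ-tail : ∀ {n} (f : Fin (suc n) → ℕ) → ∑ℕ (f ∘ suc) ≤ ∑ℕ f
  ∑ℕ-tail f = ℕ.≤-trans (ℕ.m≤n+m _ (f zero)) (ℕ.≤-reflexive (sym (∑ℕ-∷ f)))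

  ‖L₀₀‖≤‖L‖ : ‖ L₀₀ ‖ ≤ ‖ L ‖
  ‖L₀₀‖≤‖L‖ = ℕ.≤-trans (∑ℕ-mono λ i → ∑ℕ-tail λ j → ∣ L (suc i) j ∣) (∑ℕ-tail λ i → ∑ℕ λ j → ∣ L i j ∣)

  cofactor₀₀ : cofactor zero zero ≡ Resolvent.χ L₀₀ (+ (c ℕ.+ suc y))
  cofactor₀₀ = trans (det-≔-zero shifted (δ zero)) (trans
    (∑-cong λ j → swap (sgn j) (δ zero j) (det (minor shifted j)))
    (trans (∑-δ zero λ j → sgn j * det (minor shifted j)) (ℤ.*-identityˡ (det (minor shifted zero)))))
    where
    swap : ∀ a b c → a * (b * c) ≡ b * (a * c)
    swap = solve-∀

  ∣C∣≡0 : ∣ cofactor zero zero ∣ ≡ 0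
  ∣C∣≡0 = ℕ.n≤0⇒n≡0 (begin
    ∣ cofactor zero zero ∣  ≤⟨ ∑ℕ-≥ (λ k → ∣ cofactor zero k ∣) zero ⟩
    rowNorm zero            ≤⟨ ℕ.m≤n*m (rowNorm zero) (suc y) ⟩
    suc y ℕ.* rowNorm zero  ≤⟨ cofactor-bound zero ⟩
    suc n ℕ.* ∣ χ ∣         ≡⟨ cong (λ z → suc n ℕ.* ∣ z ∣) χ≡0 ⟩
    suc n ℕ.* 0             ≡⟨ ℕ.*-zeroʳ (suc n) ⟩
    0                       ∎)
    where open ℕ.≤-Reasoning

module Traces {m n} (L : Matrix ℤ m) (L′ : Matrix ℤ n)
  (χ≡χ′ : ∀ x → Resolvent.χ L (+ x) ≡ Resolvent.χ L′ (+ x)) where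

  private
    module A x = Resolvent L (+ x)
    module B x = Resolvent L′ (+ x)

  -- The moments of order `suc e` are not yet known to agree, only to be small. At `y = k + 1` the
  -- bounds give `y * ∣ d ∣ * ∣ χ ∣ ≤ k * ∣ χ ∣`; cancelling `∣ χ ∣` leaves an integer `d` of
  -- absolute value below 1. The sum `c` of both norms makes one argument serve both matrices.
  tr-step : ∀ e → (∀ x → A.moment x e ≡ B.moment x e) → tr (pow L e) ≡ tr (pow L′ e)
  tr-step e eq = ℤ.i-j≡0⇒i≡j _ _ (ℤ.∣i∣≡0⇒i≡0 (small (ℕ.*-cancelʳ-≤ (y ℕ.* ∣ d ∣) k ∣ χ ∣
    {{ℕ.≢-nonZero (χ≢0 L c k (ℕ.m≤m+n ‖ L ‖ ‖ L′ ‖) ∘ ℤ.∣i∣≡0⇒i≡0)}} (begin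
    y ℕ.* ∣ d ∣ ℕ.* ∣ χ ∣              ≡⟨ trans (ℕ.*-assoc y ∣ d ∣ ∣ χ ∣) (cong (y ℕ.*_) (sym (ℤ.abs-* d χ))) ⟩
    y ℕ.* ∣ d * χ ∣                    ≡⟨ cong (λ z → y ℕ.* ∣ z ∣) difference ⟩
    y ℕ.* ∣ M′ - M ∣                   ≤⟨ ℕ.*-monoʳ-≤ y (ℤ.∣i-j∣≤∣i∣+∣j∣ M′ M) ⟩
    y ℕ.* (∣ M′ ∣ ℕ.+ ∣ M ∣)           ≡⟨ ℕ.*-distribˡ-+ y ∣ M′ ∣ ∣ M ∣ ⟩
    y ℕ.* ∣ M′ ∣ ℕ.+ y ℕ.* ∣ M ∣       ≤⟨ ℕ.+-mono-≤
                                            (Bounds.moment-bound L′ c y (ℕ.m≤n+m ‖ L′ ‖ ‖ L ‖) (suc e))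
                                            (Bounds.moment-bound L c y (ℕ.m≤m+n ‖ L ‖ ‖ L′ ‖) (suc e)) ⟩
    n ℕ.* ∣ B.χ x ∣ ℕ.* w′ ℕ.+ m ℕ.* ∣ χ ∣ ℕ.* w
                                       ≡⟨ cong (λ z → n ℕ.* ∣ z ∣ ℕ.* w′ ℕ.+ m ℕ.* ∣ χ ∣ ℕ.* w) (χ≡χ′ x) ⟨
    n ℕ.* ∣ χ ∣ ℕ.* w′ ℕ.+ m ℕ.* ∣ χ ∣ ℕ.* w
                                       ≡⟨ collect n w′ m w ∣ χ ∣ ⟩
    k ℕ.* ∣ χ ∣                        ∎))))
    where
    open ℕ.≤-Reasoning
    w  = ‖ (λ i k → pow L (suc e) k i) ‖
    w′ = ‖ (λ i k → pow L′ (suc e) k i) ‖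
    k c y x : ℕ
    k = n ℕ.* w′ ℕ.+ m ℕ.* w
    c = ‖ L ‖ ℕ.+ ‖ L′ ‖
    y = suc k
    x = c ℕ.+ y
    χ = A.χ x
    M  = A.moment x (suc e)
    M′ = B.moment x (suc e)
    t  = tr (pow L e)
    t′ = tr (pow L′ e)
    d  = t - t′

    collect : ∀ n w′ m w z → n ℕ.* z ℕ.* w′ ℕ.+ m ℕ.* z ℕ.* w ≡ (n ℕ.* w′ ℕ.+ m ℕ.* w) ℕ.* z
    collect = ℕ-solve-∀

    small : y ℕ.* ∣ d ∣ ≤ k → ∣ d ∣ ≡ 0
    small with ∣ d ∣
    ... | zero   = λ _ → refl
    ... | suc d′ = λ le → ⊥-elim (ℕ.<-irrefl refl (ℕ.≤-trans (ℕ.m≤m*n y (suc d′)) le))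

    rearrange : ∀ χ t t′ M → (t - t′) * χ ≡ (M + χ * t) - (M + χ * t′)
    rearrange = solve-∀
    rearrange′ : ∀ χ t′ M M′ → (M′ + χ * t′) - (M + χ * t′) ≡ M′ - M
    rearrange′ = solve-∀

    difference : d * χ ≡ M′ - M
    difference = trans (rearrange χ t t′ M) (trans
      (cong (_- (M + χ * t′)) (trans (sym (A.moment-suc x e)) (trans (cong (+ x *_) (eq x)) (trans (B.moment-suc x e)
        (cong (λ z → M′ + z * t′) (sym (χ≡χ′ x)))))))
      (rearrange′ χ t′ M M′))

  moment-unique : ∀ e x → A.moment x e ≡ B.moment x e
  moment-unique zero    x = moment-0-unique L L′ χ≡χ′ x
  moment-unique (suc e) x = ℤ+.∙-cancelʳ (A.χ x * tr (pow L e)) (A.moment x (suc e)) (B.moment x (suc e)) (begin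
    A.moment x (suc e) + A.χ x * tr (pow L e)    ≡⟨ A.moment-suc x e ⟨
    + x * A.moment x e                           ≡⟨ cong (+ x *_) (moment-unique e x) ⟩
    + x * B.moment x e                           ≡⟨ B.moment-suc x e ⟩
    B.moment x (suc e) + B.χ x * tr (pow L′ e)
      ≡⟨ cong₂ (λ a b → B.moment x (suc e) + a * b) (χ≡χ′ x) (tr-step e (moment-unique e)) ⟨
    B.moment x (suc e) + A.χ x * tr (pow L e)    ∎)
    where open ≡-Reasoning

  tr-unique : ∀ e → tr (pow L e) ≡ tr (pow L′ e)
  tr-unique e = tr-step e (moment-unique e)

-- Descent from K to ℤ

module FromInteger {c ℓ} (R : CommutativeRing c ℓ) where
  open CommutativeRing R
    using (Carrier; _≈_; 0#; 1#; ring; semiring; setoid; rawRing; +-cong; +-congˡ; +-congʳ; *-cong; -‿cong;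
           +-identityˡ; +-identityʳ; +-comm; +-assoc; -‿inverseʳ; zeroˡ; distribʳ; *-identityˡ)
    renaming (_+_ to _+ᴿ_; _*_ to _*ᴿ_; -_ to -ᴿ_; _-_ to _-ᴿ_; refl to ≈-refl; sym to ≈-sym; trans to ≈-trans)
  open import Algebra.Properties.Ring ring using (-0#≈0#; -‿distribˡ-*; -‿+-comm; -‿involutive)
  open import Algebra.Properties.Semiring.Mult semiring using (×-homo-+; ×-homo-1) renaming (_×_ to _×ᴿ_)
  open import Relation.Binary.Reasoning.Setoid setoid

  ι : ℤ → Carrier
  ι (+ n)    = n ×ᴿ 1#
  ι -[1+ n ] = -ᴿ (suc n ×ᴿ 1#)

  ι-⊖ : ∀ m n → ι (m ⊖ n) ≈ m ×ᴿ 1# -ᴿ n ×ᴿ 1#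
  ι-⊖ m       zero    = ≈-sym (≈-trans (+-congˡ -0#≈0#) (+-identityʳ (m ×ᴿ 1#)))
  ι-⊖ zero    (suc n) = ≈-sym (+-identityˡ _)
  ι-⊖ (suc m) (suc n) = begin
    ι (suc m ⊖ suc n)                      ≡⟨ cong ι (ℤ.[1+m]⊖[1+n]≡m⊖n m n) ⟩
    ι (m ⊖ n)                              ≈⟨ ι-⊖ m n ⟩
    a -ᴿ b                                 ≈⟨ +-congʳ (+-identityʳ a) ⟨
    a +ᴿ 0# -ᴿ b                           ≈⟨ +-congʳ (+-congˡ (-‿inverseʳ 1#)) ⟨
    a +ᴿ (1# -ᴿ 1#) -ᴿ b                   ≈⟨ +-congʳ (≈-trans (≈-sym (+-assoc a 1# (-ᴿ 1#))) (+-congʳ (+-comm a 1#))) ⟩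
    1# +ᴿ a -ᴿ 1# -ᴿ b                     ≈⟨ +-assoc _ _ _ ⟩
    1# +ᴿ a +ᴿ (-ᴿ 1# -ᴿ b)                ≈⟨ +-congˡ (-‿+-comm 1# b) ⟩
    1# +ᴿ a -ᴿ (1# +ᴿ b)                   ∎
    where
    a = m ×ᴿ 1#
    b = n ×ᴿ 1#

  ι-+ : ∀ i j → ι (i + j) ≈ ι i +ᴿ ι j
  ι-+ (+ m)    (+ n)    = ×-homo-+ 1# m n
  ι-+ (+ m)    -[1+ n ] = ι-⊖ m (suc n)
  ι-+ -[1+ m ] (+ n)    = ≈-trans (ι-⊖ n (suc m)) (+-comm _ _)
  ι-+ -[1+ m ] -[1+ n ] = begin
    -ᴿ (suc (suc (m ℕ.+ n)) ×ᴿ 1#)            ≡⟨ cong (λ k → -ᴿ (suc k ×ᴿ 1#)) (ℕ.+-suc m n) ⟨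
    -ᴿ ((suc m ℕ.+ suc n) ×ᴿ 1#)              ≈⟨ -‿cong (×-homo-+ 1# (suc m) (suc n)) ⟩
    -ᴿ (suc m ×ᴿ 1# +ᴿ suc n ×ᴿ 1#)           ≈⟨ -‿+-comm _ _ ⟨
    -ᴿ (suc m ×ᴿ 1#) -ᴿ suc n ×ᴿ 1#           ∎

  ι-neg : ∀ i → ι (- i) ≈ -ᴿ ι i
  ι-neg (+ zero)  = ≈-sym -0#≈0#
  ι-neg (+ suc n) = ≈-refl
  ι-neg -[1+ n ]  = ≈-sym (-‿involutive _)

  ι-minus : ∀ i j → ι (i - j) ≈ ι i -ᴿ ι j
  ι-minus i j = ≈-trans (ι-+ i (- j)) (+-congˡ (ι-neg j))

  ι-1 : ι 1ℤ ≈ 1#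
  ι-1 = ×-homo-1 1#

  ι-*-+ : ∀ m j → ι (+ m * j) ≈ ι (+ m) *ᴿ ι j
  ι-*-+ zero    j = ≈-sym (zeroˡ (ι j))
  ι-*-+ (suc m) j = begin
    ι (+ suc m * j)                    ≡⟨ cong ι (ℤ.suc-* (+ m) j) ⟩
    ι (j + + m * j)                    ≈⟨ ι-+ j (+ m * j) ⟩
    ι j +ᴿ ι (+ m * j)                 ≈⟨ +-cong (≈-sym (*-identityˡ (ι j))) (ι-*-+ m j) ⟩
    1# *ᴿ ι j +ᴿ ι (+ m) *ᴿ ι j        ≈⟨ distribʳ (ι j) 1# (ι (+ m)) ⟨
    ι (+ suc m) *ᴿ ι j                 ∎

  ι-* : ∀ i j → ι (i * j) ≈ ι i *ᴿ ι j
  ι-* (+ m)    j = ι-*-+ m j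
  ι-* -[1+ m ] j = begin
    ι (-[1+ m ] * j)        ≡⟨ cong ι (ℤ.neg-distribˡ-* (+ suc m) j) ⟨
    ι (- (+ suc m * j))     ≈⟨ ι-neg (+ suc m * j) ⟩
    -ᴿ ι (+ suc m * j)      ≈⟨ -‿cong (ι-*-+ (suc m) j) ⟩
    -ᴿ (ι (+ suc m) *ᴿ ι j) ≈⟨ -‿distribˡ-* (ι (+ suc m)) (ι j) ⟩
    ι -[1+ m ] *ᴿ ι j       ∎

  -- Characteristic zero enters here: it lets an equation between determinants in the field be read
  -- back over ℤ.
  ι-injective : (∀ k → k ×ᴿ 1# ≈ 0# → k ≡ 0) → ∀ i j → ι i ≈ ι j → i ≡ j
  ι-injective char0 i j ιi≈ιj = ℤ.i-j≡0⇒i≡j i j (ι-zero (i - j) (begin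
    ι (i - j)     ≈⟨ ι-minus i j ⟩
    ι i -ᴿ ι j    ≈⟨ +-congʳ ιi≈ιj ⟩
    ι j -ᴿ ι j    ≈⟨ -‿inverseʳ (ι j) ⟩
    0#            ∎))
    where
    ι-zero : ∀ k → ι k ≈ 0# → k ≡ 0ℤ
    ι-zero (+ n)    eq = cong +_ (char0 n eq)
    ι-zero -[1+ n ] eq with () ← char0 (suc n) (≈-trans (≈-sym (-‿involutive _)) (≈-trans (-‿cong eq) -0#≈0#))

  open Determinant rawRing using () renaming (det to detᴿ)
  open RawMonoidDefs (RawRing.+-rawMonoid rawRing) using () renaming (sum to sumᴿ)
  open RawSemiringDefs (RawRing.rawSemiring rawRing) using () renaming (_^_ to _^ᴿ_)

  ι-sum : ∀ {n} {f : Fin n → Carrier} (g : Fin n → ℤ) → (∀ i → f i ≈ ι (g i)) → sumᴿ f ≈ ι (Σℤ.sum g)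
  ι-sum {zero}  g eq = ≈-refl
  ι-sum {suc n} g eq = ≈-trans (+-cong (eq zero) (ι-sum (g ∘ suc) (eq ∘ suc))) (≈-sym (ι-+ (g zero) (Σℤ.sum (g ∘ suc))))

  ι-sign : ∀ k → (-ᴿ 1#) ^ᴿ k ≈ ι (-1ℤ ^ℤ k)
  ι-sign zero    = ≈-sym ι-1
  ι-sign (suc k) = ≈-trans (*-cong (-‿cong (≈-sym ι-1)) (ι-sign k)) (≈-sym (ι-* -1ℤ (-1ℤ ^ℤ k)))

  ι-det : ∀ {n} {M : Matrix Carrier n} (N : Matrix ℤ n) → (∀ i j → M i j ≈ ι (N i j)) → detᴿ M ≈ ι (Raw.det N)
  ι-det {zero}  N eq = ≈-sym ι-1
  ι-det {suc n} N eq = ι-sum (λ j → sgn j * (N zero j * Raw.det (minor N j))) λ j → ≈-trans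
    (*-cong (ι-sign (toℕ j)) (≈-trans (*-cong (eq zero j) (ι-det (minor N j) λ i k → eq (suc i) (punchIn j k)))
      (≈-sym (ι-* (N zero j) (Raw.det (minor N j))))))
    (≈-sym (ι-* (sgn j) (N zero j * Raw.det (minor N j))))

-- Integral Laplacians and their characteristic polynomials

module _ {n} (G : Graph n) where
  open Graph G

  adjacent : Matrix ℤ n
  adjacent i j = if does (i ~? j) then 1ℤ else 0ℤ

  laplacianℤ : Matrix ℤ n
  laplacianℤ i j = + degree i * δ i j - adjacent i j

module _ {c ℓ₁ ℓ₂} (K : HeytingField c ℓ₁ ℓ₂) (char0 : Laplacian.CharacteristicZero K) where
  open Laplacian K hiding (_-_; det)
  private
    R = HeytingCommutativeRing.commutativeRing (HeytingField.heytingCommutativeRing K)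
    open FromInteger R
    module R = CommutativeRing R

  charPoly-laplacian : ∀ {n} (G : Graph n) x →
    charPoly (laplacian G) (ι (+ x)) R.≈ ι (Resolvent.χ (laplacianℤ G) (+ x))
  charPoly-laplacian G x = R.trans
    (ι-det shifted λ i j → minus (+ x * δ i j) (laplacianℤ G i j) (diag (λ _ → x) i j)
      (minus (+ degree i * δ i j) (adjacent G i j) (diag degree i j) (adj i j)))
    (R.reflexive (cong ι (det-def shifted)))
    where
    open Graph G
    open Resolvent (laplacianℤ G) (+ x)
    diag : ∀ d i j → diagonal (λ i → d i ×ᴷ 1#) i j R.≈ ι (+ d i * δ i j)
    diag d i j with does (i Fin.≟ j)
    ... | Bool.true  = R.reflexive (cong ι (sym (ℤ.*-identityʳ (+ d i))))
    ... | Bool.false = R.reflexive (cong ι (sym (ℤ.*-zeroʳ (+ d i))))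
    adj : ∀ i j → adjacency G i j R.≈ ι (adjacent G i j)
    adj i j with does (i ~? j)
    ... | Bool.true  = R.sym ι-1
    ... | Bool.false = R.refl
    minus : ∀ {a b} i j → a R.≈ ι i → b R.≈ ι j → a R.- b R.≈ ι (i - j)
    minus i j a≈ b≈ = R.trans (R.+-cong a≈ (R.-‿cong b≈)) (R.sym (ι-minus i j))

  -- The product over `σ` is the common value of both characteristic polynomials and is eliminated
  -- between them.
  sameSpectrum⇒χ : ∀ {m n} (G : Graph m) (H : Graph n) → SameLaplacianSpectrum G H →
    ∀ x → Resolvent.χ (laplacianℤ H) (+ x) ≡ Resolvent.χ (laplacianℤ G) (+ x)
  sameSpectrum⇒χ G H (σ , σ-G , σ-H) x = ι-injective char0 _ _ (R.trans
    (R.sym (charPoly-laplacian H x)) (R.trans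
    (R.trans (σ-H (ι (+ x))) (R.sym (σ-G (ι (+ x)))))
    (charPoly-laplacian G x)))

-- The trace form

-- The Frobenius inner product, tr (Xᵀ Y).
⟨_,_⟩ : ∀ {n} → Matrix ℤ n → Matrix ℤ n → ℤ
⟨ X , Y ⟩ = ∑ λ i → ∑ λ j → X i j * Y i j

⟨⟩-comm : ∀ {n} (X Y : Matrix ℤ n) → ⟨ X , Y ⟩ ≡ ⟨ Y , X ⟩
⟨⟩-comm X Y = ∑-cong λ i → ∑-cong λ j → ℤ.*-comm (X i j) (Y i j)

⟨⟩-∑ˡ : ∀ {m n} (c : Fin m → ℤ) (X : Fin m → Matrix ℤ n) Y →
  ⟨ (λ i j → ∑ λ a → c a * X a i j) , Y ⟩ ≡ ∑ λ a → c a * ⟨ X a , Y ⟩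
⟨⟩-∑ˡ c X Y = begin
  ∑ (λ i → ∑ λ j → ∑ (λ a → c a * X a i j) * Y i j)
    ≡⟨ (∑-cong λ i → ∑-cong λ j → trans (sym (∑-*ʳ _ (Y i j))) (∑-cong λ a → ℤ.*-assoc (c a) (X a i j) (Y i j))) ⟩
  ∑ (λ i → ∑ λ j → ∑ λ a → c a * (X a i j * Y i j))
    ≡⟨ (∑-cong λ i → ∑-comm λ j a → c a * (X a i j * Y i j)) ⟩
  ∑ (λ i → ∑ λ a → ∑ λ j → c a * (X a i j * Y i j))
    ≡⟨ (∑-comm λ i a → ∑ λ j → c a * (X a i j * Y i j)) ⟩
  ∑ (λ a → ∑ λ i → ∑ λ j → c a * (X a i j * Y i j))
    ≡⟨ (∑-cong λ a → trans (∑-cong λ i → ∑-*ˡ (c a) _) (∑-*ˡ (c a) _)) ⟩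
  ∑ (λ a → c a * ⟨ X a , Y ⟩) ∎
  where open ≡-Reasoning

⟨⟩-quadratic : ∀ {m n} (c : Fin m → ℤ) (X : Fin m → Matrix ℤ n) →
  let Q = λ i j → ∑ λ a → c a * X a i j in
  ⟨ Q , Q ⟩ ≡ ∑ λ a → c a * ∑ λ b → c b * ⟨ X a , X b ⟩
⟨⟩-quadratic c X = trans (⟨⟩-∑ˡ c X _) (∑-cong λ a → cong (c a *_) (trans
  (⟨⟩-comm (X a) _) (trans (⟨⟩-∑ˡ c X (X a)) (∑-cong λ b → cong (c b *_) (⟨⟩-comm (X b) (X a))))))

0≤i*i : ∀ i → 0ℤ ≤ℤ i * i
0≤i*i (+ n)    = subst (0ℤ ≤ℤ_) (ℤ.pos-* n n) (+≤+ z≤n)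
0≤i*i -[1+ n ] = +≤+ z≤n

∑-≥0 : ∀ {n} {f : Fin n → ℤ} → (∀ i → 0ℤ ≤ℤ f i) → 0ℤ ≤ℤ ∑ f
∑-≥0 {zero}  {f} 0≤f = ℤ.≤-reflexive (sym (∑-[] f))
∑-≥0 {suc n} {f} 0≤f = subst (0ℤ ≤ℤ_) (sym (∑-∷ f)) (ℤ.+-mono-≤ (0≤f zero) (∑-≥0 (0≤f ∘ suc)))

i+j≡0⇒i≡0 : ∀ {i j} → 0ℤ ≤ℤ i → 0ℤ ≤ℤ j → i + j ≡ 0ℤ → i ≡ 0ℤ
i+j≡0⇒i≡0 {+ zero}  {+ n} _ _ _  = refl
i+j≡0⇒i≡0 {+ suc m} {+ n} _ _ ()

∑≡0⇒≡0 : ∀ {n} {f : Fin n → ℤ} → (∀ i → 0ℤ ≤ℤ f i) → ∑ f ≡ 0ℤ → ∀ i → f i ≡ 0ℤ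
∑≡0⇒≡0 {suc n} {f} 0≤f ∑≡0 zero    = i+j≡0⇒i≡0 (0≤f zero) (∑-≥0 (0≤f ∘ suc)) (trans (sym (∑-∷ f)) ∑≡0)
∑≡0⇒≡0 {suc n} {f} 0≤f ∑≡0 (suc i) = ∑≡0⇒≡0 (0≤f ∘ suc)
  (i+j≡0⇒i≡0 (∑-≥0 (0≤f ∘ suc)) (0≤f zero) (trans (ℤ.+-comm _ (f zero)) (trans (sym (∑-∷ f)) ∑≡0))) i

⟨⟩-definite : ∀ {n} (X : Matrix ℤ n) → ⟨ X , X ⟩ ≡ 0ℤ → ∀ i j → X i j ≡ 0ℤ
⟨⟩-definite X ⟨X,X⟩≡0 i j = [ (λ x → x) , (λ x → x) ]′ (ℤ.i*j≡0⇒i≡0∨j≡0 (X i j)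
  (∑≡0⇒≡0 (λ j → 0≤i*i (X i j)) (∑≡0⇒≡0 (λ i → ∑-≥0 λ j → 0≤i*i (X i j)) ⟨X,X⟩≡0 i) j))

∑-const : ∀ n c → ∑ {n} (λ _ → c) ≡ + n * c
∑-const zero    c = trans (∑-[] _) (sym (ℤ.*-zeroˡ c))
∑-const (suc n) c = trans (∑-∷ _) (trans (cong (λ z → c + z) (∑-const n c)) (sym (ℤ.suc-* (+ n) c)))

-- The all-ones matrix J comes first, then I, L, L² and so on. J is included because the Laplacian
-- of the complement involves it.
basis : ∀ {n} → Matrix ℤ n → ∀ {d} → Fin (suc d) → Matrix ℤ n
basis L zero    _ _ = 1ℤ
basis L (suc a)     = pow L (toℕ a)

tr-pow-0 : ∀ {n} (L : Matrix ℤ n) → tr (pow L 0) ≡ + n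
tr-pow-0 {n} L = trans (∑-cong δ-refl) (trans (∑-const n 1ℤ) (ℤ.*-identityʳ (+ n)))

module Gram {n} (L : Matrix ℤ n) (L-sym : ∀ i j → L i j ≡ L j i) (L-row : ∀ i → ∑ (L i) ≡ 0ℤ) where
  open ≡-Reasoning

  -- Symmetry of `L` moves its factors one at a time from the left argument to the right.
  ⟨pow,pow⟩ : ∀ a b → ⟨ pow L a , pow L b ⟩ ≡ tr (pow L (a ℕ.+ b))
  ⟨pow,pow⟩ zero    b = ∑-cong λ i → ∑-δ i (pow L b i)
  ⟨pow,pow⟩ (suc a) b = begin
    ∑ (λ l → ∑ λ i → ∑ (λ k → L k l * P k i) * Q l i)
      ≡⟨ (∑-cong λ l → ∑-cong λ i → trans (sym (∑-*ʳ _ (Q l i))) (∑-cong λ k → trans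
           (cong (λ z → z * P k i * Q l i) (L-sym k l)) (swap (L l k) (P k i) (Q l i)))) ⟩
    ∑ (λ l → ∑ λ i → ∑ λ k → P k i * (L l k * Q l i))
      ≡⟨ trans (∑-cong λ l → ∑-comm _) (∑-comm _) ⟩
    ∑ (λ k → ∑ λ l → ∑ λ i → P k i * (L l k * Q l i))
      ≡⟨ (∑-cong λ k → trans (∑-comm _) (∑-cong λ i → ∑-*ˡ (P k i) _)) ⟩
    ⟨ pow L a , pow L (suc b) ⟩
      ≡⟨ ⟨pow,pow⟩ a (suc b) ⟩
    tr (pow L (a ℕ.+ suc b))
      ≡⟨ cong (λ e → tr (pow L e)) (ℕ.+-suc a b) ⟩
    tr (pow L (suc a ℕ.+ b)) ∎
    where
    P = pow L a
    Q = pow L b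
    swap : ∀ a b c → a * b * c ≡ b * (a * c)
    swap = solve-∀

  -- This is the inner product with J, which zero row sums annihilate. With `⟨pow,pow⟩` it reduces
  -- the Gram matrix of `basis` to the vertex count and power traces.
  ∑∑-pow : ∀ a → ∑ (λ i → ∑ λ j → pow L (suc a) i j) ≡ 0ℤ
  ∑∑-pow a = begin
    ∑ (λ l → ∑ λ i → ∑ λ k → L k l * P k i)
      ≡⟨ trans (∑-comm _) (∑-cong λ i → ∑-comm _) ⟩
    ∑ (λ i → ∑ λ k → ∑ λ l → L k l * P k i)
      ≡⟨ (∑-0 λ i → ∑-0 λ k → trans (∑-*ʳ (L k) (P k i)) (trans (cong (_* P k i) (L-row k)) (ℤ.*-zeroˡ (P k i)))) ⟩
    0ℤ ∎
    where P = pow L a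

combination : ∀ {d} → (Fin (suc d) → ℤ) → ∀ {n} → Matrix ℤ n → Matrix ℤ n
combination c M i j = ∑ λ a → c a * basis M a i j

module SameGram {m n} (L : Matrix ℤ m) (L′ : Matrix ℤ n)
  (L-sym : ∀ i j → L i j ≡ L j i) (L-row : ∀ i → ∑ (L i) ≡ 0ℤ)
  (L′-sym : ∀ i j → L′ i j ≡ L′ j i) (L′-row : ∀ i → ∑ (L′ i) ≡ 0ℤ)
  (tr≡ : ∀ e → tr (pow L e) ≡ tr (pow L′ e)) where

  private
    module A = Gram L L-sym L-row
    module B = Gram L′ L′-sym L′-row

  size≡ : m ≡ n
  size≡ = ℤ.+-injective (trans (sym (tr-pow-0 L)) (trans (tr≡ 0) (tr-pow-0 L′)))

  sums≡ : ∀ a → ∑ (λ i → ∑ λ j → pow L a i j) ≡ ∑ (λ i → ∑ λ j → pow L′ a i j)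
  sums≡ (suc a) = trans (A.∑∑-pow a) (sym (B.∑∑-pow a))
  sums≡ zero    = trans (total L) (trans (cong +_ size≡) (sym (total L′)))
    where
    total : ∀ {k} (M : Matrix ℤ k) → ∑ (λ i → ∑ λ j → δ {k} i j) ≡ + k
    total M = trans (∑-cong λ i → trans
      (∑-cong λ j → sym (ℤ.*-identityʳ (δ i j))) (trans (∑-δ i λ _ → 1ℤ) (sym (δ-refl i)))) (tr-pow-0 M)

  gram≡ : ∀ {d} (a b : Fin (suc d)) → ⟨ basis L a , basis L b ⟩ ≡ ⟨ basis L′ a , basis L′ b ⟩
  gram≡ zero    zero    = trans (ones m) (trans (cong (λ k → + k * + k) size≡) (sym (ones n)))
    where
    ones : ∀ k → ⟨ (λ (_ _ : Fin k) → 1ℤ) , (λ _ _ → 1ℤ) ⟩ ≡ + k * + k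
    ones k = trans (∑-cong {k} λ i → trans (∑-const k 1ℤ) (ℤ.*-identityʳ (+ k))) (∑-const k (+ k))
  gram≡ zero    (suc b) = trans (∑-cong λ i → ∑-cong λ j → ℤ.*-identityˡ (pow L (toℕ b) i j)) (trans
    (sums≡ (toℕ b)) (∑-cong λ i → ∑-cong λ j → sym (ℤ.*-identityˡ (pow L′ (toℕ b) i j))))
  gram≡ (suc a) zero    = trans (⟨⟩-comm (pow L (toℕ a)) _) (trans (gram≡ zero (suc a)) (⟨⟩-comm (basis L′ {suc (toℕ a)} zero) (pow L′ (toℕ a))))
  gram≡ (suc a) (suc b) = trans (A.⟨pow,pow⟩ (toℕ a) (toℕ b)) (trans (tr≡ (toℕ a ℕ.+ toℕ b)) (sym (B.⟨pow,pow⟩ (toℕ a) (toℕ b))))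

  combination-0 : ∀ {d} (c : Fin (suc d) → ℤ) →
    (∀ i j → combination c L′ i j ≡ 0ℤ) → ∀ i j → combination c L i j ≡ 0ℤ
  combination-0 c vanish = ⟨⟩-definite (combination c L) (begin
    ⟨ combination c L , combination c L ⟩
      ≡⟨ ⟨⟩-quadratic c (basis L) ⟩
    ∑ (λ a → c a * ∑ λ b → c b * ⟨ basis L a , basis L b ⟩)
      ≡⟨ (∑-cong λ a → cong (c a *_) (∑-cong λ b → cong (c b *_) (gram≡ a b))) ⟩
    ∑ (λ a → c a * ∑ λ b → c b * ⟨ basis L′ a , basis L′ b ⟩)
      ≡⟨ ⟨⟩-quadratic c (basis L′) ⟨
    ⟨ combination c L′ , combination c L′ ⟩
      ≡⟨ (∑-0 λ i → ∑-0 λ j → cong₂ _*_ (vanish i j) (vanish i j)) ⟩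
    0ℤ ∎)
    where open ≡-Reasoning

-- Non-adjacency classes

⟦_⟧ : ∀ {p} {P : Set p} → Dec P → ℤ
⟦ P? ⟧ = if does P? then 1ℤ else 0ℤ

⟦⟧-yes : ∀ {p} {P : Set p} (P? : Dec P) → P → ⟦ P? ⟧ ≡ 1ℤ
⟦⟧-yes (yes _) _ = refl
⟦⟧-yes (no ¬p) p = ⊥-elim (¬p p)

⟦⟧-no : ∀ {p} {P : Set p} (P? : Dec P) → ¬ P → ⟦ P? ⟧ ≡ 0ℤ
⟦⟧-no (yes p) ¬p = ⊥-elim (¬p p)
⟦⟧-no (no _)  _  = refl

⟦⟧-⇔ : ∀ {p q} {P : Set p} {Q : Set q} (P? : Dec P) (Q? : Dec Q) → (P → Q) → (Q → P) → ⟦ P? ⟧ ≡ ⟦ Q? ⟧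
⟦⟧-⇔ (yes p) Q? P→Q Q→P = sym (⟦⟧-yes Q? (P→Q p))
⟦⟧-⇔ (no ¬p) Q? P→Q Q→P = sym (⟦⟧-no Q? (¬p ∘ Q→P))

⟦⟧-¬ : ∀ {p} {P : Set p} (P? : Dec P) → ⟦ P? ⟧ ≡ 1ℤ - ⟦ ¬? P? ⟧
⟦⟧-¬ (yes _) = refl
⟦⟧-¬ (no  _) = refl

count : ∀ {n ℓ} {P : U.Pred (Fin n) ℓ} → U.Decidable P → ℕ
count {zero}  P? = 0
count {suc n} P? = (if does (P? zero) then 1 else 0) ℕ.+ count (P? ∘ suc)

∑-count : ∀ {n ℓ} {P : U.Pred (Fin n) ℓ} (P? : U.Decidable P) → ∑ (λ i → ⟦ P? i ⟧) ≡ + count P?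
∑-count {zero}  P? = ∑-[] _
∑-count {suc n} P? = trans (∑-∷ _) (trans (cong (λ z → ⟦ P? zero ⟧ + z) (∑-count (P? ∘ suc))) (add (P? zero)))
  where
  add : ∀ {p} {P : Set p} (d : Dec P) → ⟦ d ⟧ + + count (P? ∘ suc) ≡ + ((if does d then 1 else 0) ℕ.+ count (P? ∘ suc))
  add (yes _) = refl
  add (no  _) = refl

length-filter-tabulate : ∀ {n ℓ a} {A : Set a} {P : U.Pred A ℓ} (P? : U.Decidable P) (f : Fin n → A) →
  length (filter P? (tabulate f)) ≡ count (P? ∘ f)
length-filter-tabulate {zero}  P? f = refl
length-filter-tabulate {suc n} P? f with does (P? (f zero))
... | Bool.true  = cong suc (length-filter-tabulate P? (f ∘ suc))
... | Bool.false = length-filter-tabulate P? (f ∘ suc)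

module Cells {n} (G : Graph n) where
  open Graph G

  cell? : ∀ i → U.Decidable (λ j → ¬ (i ~ j))
  cell? i j = ¬? (i ~? j)

  -- No vertex is adjacent to itself, so this is one more than the degree in the complement, and `E`
  -- below is I plus the adjacency matrix of the complement.
  cell : Fin n → ℕ
  cell i = count (cell? i)

  E : Matrix ℤ n
  E i j = ⟦ cell? i j ⟧

  e : Fin n → ℤ
  e i = + cell i

  ∑E : ∀ i → ∑ (E i) ≡ e i
  ∑E i = ∑-count (cell? i)

  E-sym : ∀ i j → E i j ≡ E j i
  E-sym i j = ⟦⟧-⇔ (cell? i j) (cell? j i) (λ i≁j j~i → i≁j (~-sym j~i)) (λ j≁i i~j → j≁i (~-sym i~j))

  L : Matrix ℤ n
  L = laplacianℤ G

  L-cells : ∀ i j → L i j ≡ (+ n - e i) * δ i j + (E i j - 1ℤ)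
  L-cells i j = trans (cong₂ (λ a b → a * δ i j - b) degree-e (⟦⟧-¬ (i ~? j))) (neg ((+ n - e i) * δ i j) (E i j))
    where
    neg : ∀ a b → a - (1ℤ - b) ≡ a + (b - 1ℤ)
    neg = solve-∀
    sub : ∀ a b → a - b ≡ a * 1ℤ + -1ℤ * b
    sub = solve-∀
    degree-e : + degree i ≡ + n - e i
    degree-e = begin
      + degree i                     ≡⟨ cong +_ (length-filter-tabulate (i ~?_) λ j → j) ⟩
      + count (i ~?_)                ≡⟨ ∑-count (i ~?_) ⟨
      ∑ (λ j → ⟦ i ~? j ⟧)           ≡⟨ (∑-cong λ j → trans (⟦⟧-¬ (i ~? j)) (sub 1ℤ (E i j))) ⟩
      ∑ (λ j → 1ℤ * 1ℤ + -1ℤ * E i j)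
        ≡⟨ trans (∑-+ {n} (λ _ → 1ℤ * 1ℤ) (λ j → -1ℤ * E i j))
             (cong₂ _+_ (∑-const n 1ℤ) (trans (∑-*ˡ -1ℤ (E i)) (cong (-1ℤ *_) (∑E i)))) ⟩
      + n * 1ℤ + -1ℤ * e i           ≡⟨ sub (+ n) (e i) ⟨
      + n - e i                      ∎
      where open ≡-Reasoning

  δ-cong : ∀ (f : Fin n → ℤ) i j → f i * δ i j ≡ f j * δ i j
  δ-cong f i j with i Fin.≟ j
  ... | yes refl = refl
  ... | no  _    = trans (ℤ.*-zeroʳ (f i)) (sym (ℤ.*-zeroʳ (f j)))

  L-sym : ∀ i j → L i j ≡ L j i
  L-sym i j = trans (L-cells i j) (trans
    (cong₂ (λ a b → a + (b - 1ℤ)) (trans (δ-cong (λ k → + n - e k) i j) (cong ((+ n - e j) *_) (δ-sym i j))) (E-sym i j))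
    (sym (L-cells j i)))

  L-row : ∀ i → ∑ (L i) ≡ 0ℤ
  L-row i = begin
    ∑ (L i)
      ≡⟨ (∑-cong λ j → trans (L-cells i j) (rearrange (+ n - e i) (δ i j) (E i j))) ⟩
    ∑ (λ j → δ i j * (+ n - e i) + (E i j + -1ℤ))
      ≡⟨ trans (∑-+ _ _) (cong₂ _+_ (∑-δ i λ _ → + n - e i) (trans (∑-+ (E i) (λ _ → -1ℤ)) (cong₂ _+_ (∑E i) (∑-const n -1ℤ)))) ⟩
    (+ n - e i) + (e i + + n * -1ℤ)
      ≡⟨ cancel (+ n) (e i) ⟩
    0ℤ ∎
    where
    open ≡-Reasoning
    rearrange : ∀ a d b → a * d + (b - 1ℤ) ≡ d * a + (b + -1ℤ)
    rearrange = solve-∀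
    cancel : ∀ a b → (a - b) + (b + a * -1ℤ) ≡ 0ℤ
    cancel = solve-∀

  tr-pow-1 : tr (pow L 1) ≡ ∑ (λ i → + n - e i)
  tr-pow-1 = ∑-cong λ i → begin
    ∑ (λ k → L k i * δ k i)                    ≡⟨ (∑-cong λ k → trans (ℤ.*-comm (L k i) (δ k i)) (cong (_* L k i) (δ-sym k i))) ⟩
    ∑ (λ k → δ i k * L k i)                    ≡⟨ ∑-δ i (λ k → L k i) ⟩
    L i i                                      ≡⟨ L-cells i i ⟩
    (+ n - e i) * δ i i + (E i i - 1ℤ)         ≡⟨ cong₂ (λ a b → (+ n - e i) * a + (b - 1ℤ)) (δ-refl i) (⟦⟧-yes (cell? i i) (~-irr i)) ⟩
    (+ n - e i) * 1ℤ + 0ℤ                      ≡⟨ trans (ℤ.+-identityʳ _) (ℤ.*-identityʳ (+ n - e i)) ⟩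
    + n - e i                                  ∎
    where open ≡-Reasoning

  -- The square of the symmetric matrix `E`: it counts the vertices non-adjacent to both `i` and
  -- `j`.
  common : Matrix ℤ n
  common i j = ∑ λ k → E i k * E j k

  pow-1 : ∀ i j → pow L 1 i j ≡ L i j
  pow-1 i j = trans (∑-cong λ k → trans (ℤ.*-comm (L k i) (δ k j)) (cong (_* L k i) (δ-sym k j)))
    (trans (∑-δ j λ k → L k i) (L-sym j i))

  pow-2 : ∀ i j → pow L 2 i j ≡
    (+ n - e i) * L i j + (+ n - e j) * (E i j - 1ℤ) + (common i j - e i - e j + + n)
  pow-2 i j = begin
    ∑ (λ k → L k i * pow L 1 k j)
      ≡⟨ (∑-cong λ k → trans
           (cong₂ _*_ (trans (L-sym k i) (L-cells i k)) (trans (pow-1 k j) (trans (L-sym k j) (L-cells j k))))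
           (trans (expand u (δ i k) (E i k) v (δ j k) (E j k)) (cong₂ (λ a b → δ i k * (u * a) + b) (sym (L-cells j k)) refl))) ⟩
    ∑ (λ k → δ i k * (u * L j k) + (δ j k * (v * (E i k - 1ℤ)) + (E i k * E j k + (-1ℤ * E i k + (-1ℤ * E j k + 1ℤ)))))
      ≡⟨ trans (∑-+ _ _) (cong₂ _+_ (∑-δ i λ k → u * L j k) (trans (∑-+ _ _) (cong₂ _+_ (∑-δ j λ k → v * (E i k - 1ℤ))
           (trans (∑-+ _ _) (cong (λ z → common i j + z) (trans (∑-+ _ _) (cong₂ _+_ (neg i) (trans (∑-+ _ _) (cong₂ _+_ (neg j) (∑-const n 1ℤ)))))))))) ⟩
    u * L j i + (v * (E i j - 1ℤ) + (common i j + (-1ℤ * e i + (-1ℤ * e j + + n * 1ℤ))))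
      ≡⟨ cong (λ z → u * z + (v * (E i j - 1ℤ) + (common i j + (-1ℤ * e i + (-1ℤ * e j + + n * 1ℤ))))) (L-sym j i) ⟩
    u * L i j + (v * (E i j - 1ℤ) + (common i j + (-1ℤ * e i + (-1ℤ * e j + + n * 1ℤ))))
      ≡⟨ collect (u * L i j) (v * (E i j - 1ℤ)) (common i j) (e i) (e j) (+ n) ⟩
    u * L i j + v * (E i j - 1ℤ) + (common i j - e i - e j + + n) ∎
    where
    open ≡-Reasoning
    u = + n - e i
    v = + n - e j
    neg : ∀ i → ∑ (λ k → -1ℤ * E i k) ≡ -1ℤ * e i
    neg i = trans (∑-*ˡ -1ℤ (E i)) (cong (-1ℤ *_) (∑E i))
    expand : ∀ u d a v d′ b → (u * d + (a - 1ℤ)) * (v * d′ + (b - 1ℤ)) ≡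
      d * (u * (v * d′ + (b - 1ℤ))) + (d′ * (v * (a - 1ℤ)) + (a * b + (-1ℤ * a + (-1ℤ * b + 1ℤ))))
    expand = solve-∀
    collect : ∀ a b c x y n → a + (b + (c + (-1ℤ * x + (-1ℤ * y + n * 1ℤ)))) ≡ a + b + (c - x - y + n)
    collect = solve-∀

-- With L̄ = n I - J - L the Laplacian of the complement, these are the
-- coefficients of L̄ (L̄ - q I) in terms of J, I, L and L².
coefficients : ℕ → ℤ → Fin 4 → ℤ
coefficients n q 0F = q - + n
coefficients n q 1F = + n * (+ n - q)
coefficients n q 2F = q - + n - + n
coefficients n q 3F = 1ℤ

module Combination {n} (G : Graph n) (q : ℕ) where
  open Cells G

  Q : Matrix ℤ n
  Q = combination (coefficients n (+ q)) L

  -- The Laplacian of the complement is the diagonal matrix of `e` minus `E`. Multiplying out its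
  -- square minus `q` times itself gives the right side, from which `n` has disappeared.
  Q-cells : ∀ i j → Q i j ≡
    common i j + δ i j * (e i * e i - + q * e i) + E i j * (+ q - e i - e j)
  Q-cells i j = begin
    Q i j
      ≡⟨ trans (∑-∷ _) (cong (λ z → c 0F * 1ℤ + z) (trans (∑-∷ _) (cong (λ z → c 1F * δ i j + z) (trans (∑-∷ _)
           (cong (λ z → c 2F * pow L 1 i j + z) (trans (∑-∷ _) (cong (λ z → c 3F * pow L 2 i j + z) (∑-[] _)))))))) ⟩
    c 0F * 1ℤ + (c 1F * δ i j + (c 2F * pow L 1 i j + (c 3F * pow L 2 i j + 0ℤ)))
      ≡⟨ cong₂ (λ a b → c 0F * 1ℤ + (c 1F * δ i j + (c 2F * a + (c 3F * b + 0ℤ)))) (trans (pow-1 i j) (L-cells i j))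
           (trans (pow-2 i j) (cong (λ z → (+ n - e i) * z + (+ n - e j) * (E i j - 1ℤ) + (common i j - e i - e j + + n)) (L-cells i j))) ⟩
    _ ≡⟨ identity (+ n) (+ q) (δ i j) (E i j) (e i) (e j) (common i j) ⟩
    common i j + δ i j * (e i * e i - + q * e i) + E i j * (+ q - e i - e j) ∎
    where
    open ≡-Reasoning
    c = coefficients n (+ q)
    identity : ∀ n q d ε x y s →
      (q - n) * 1ℤ + (n * (n - q) * d + ((q - n - n) * ((n - x) * d + (ε - 1ℤ)) + (1ℤ *
        ((n - x) * ((n - x) * d + (ε - 1ℤ)) + (n - y) * (ε - 1ℤ) + (s - x - y + n)) + 0ℤ))) ≡
      s + d * (x * x - q * x) + ε * (q - x - y)
    identity = solve-∀

-- Non-adjacency is reflexive and symmetric in any graph. With transitivity and the size condition,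
-- the complement is a disjoint union of copies of K₁ and K_q.
record Clustered {n} (G : Graph n) (q : ℕ) : Set where
  open Graph G
  open Cells G
  field
    ≁-trans   : ∀ {i j k} → ¬ (i ~ j) → ¬ (j ~ k) → ¬ (i ~ k)
    cell-size : ∀ i → cell i ≡ 1 ⊎ cell i ≡ q

module _ {n} (G : Graph n) (q : ℕ) where
  open Graph G
  open Cells G
  open Combination G q

  private
    E-yes : ∀ {i j} → ¬ (i ~ j) → E i j ≡ 1ℤ
    E-yes {i} {j} = ⟦⟧-yes (cell? i j)

    E-no : ∀ {i j} → i ~ j → E i j ≡ 0ℤ
    E-no {i} {j} i~j = ⟦⟧-no (cell? i j) λ i≁j → i≁j i~j

    0≤⟦⟧*⟦⟧ : ∀ {p r} {P : Set p} {R : Set r} (P? : Dec P) (R? : Dec R) → 0ℤ ≤ℤ ⟦ P? ⟧ * ⟦ R? ⟧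
    0≤⟦⟧*⟦⟧ (yes _) (yes _) = +≤+ z≤n
    0≤⟦⟧*⟦⟧ (yes _) (no  _) = +≤+ z≤n
    0≤⟦⟧*⟦⟧ (no  _) (yes _) = +≤+ z≤n
    0≤⟦⟧*⟦⟧ (no  _) (no  _) = +≤+ z≤n

    ⟦⟧-idem : ∀ {p} {P : Set p} (P? : Dec P) → ⟦ P? ⟧ * ⟦ P? ⟧ ≡ ⟦ P? ⟧
    ⟦⟧-idem (yes _) = refl
    ⟦⟧-idem (no  _) = refl

  Q-diagonal : ∀ i → Q i i ≡ (e i - 1ℤ) * (e i - + q)
  Q-diagonal i = begin
    Q i i
      ≡⟨ Q-cells i i ⟩
    common i i + δ i i * (e i * e i - + q * e i) + E i i * (+ q - e i - e i)
      ≡⟨ cong₂ (λ a b → a + b * (e i * e i - + q * e i) + E i i * (+ q - e i - e i))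
           (trans (∑-cong λ k → ⟦⟧-idem (cell? i k)) (∑E i)) (δ-refl i) ⟩
    e i + 1ℤ * (e i * e i - + q * e i) + E i i * (+ q - e i - e i)
      ≡⟨ cong (λ z → e i + 1ℤ * (e i * e i - + q * e i) + z * (+ q - e i - e i)) (E-yes (~-irr i)) ⟩
    e i + 1ℤ * (e i * e i - + q * e i) + 1ℤ * (+ q - e i - e i)
      ≡⟨ factor (e i) (+ q) ⟩
    (e i - 1ℤ) * (e i - + q) ∎
    where
    open ≡-Reasoning
    factor : ∀ x q → x + 1ℤ * (x * x - q * x) + 1ℤ * (q - x - x) ≡ (x - 1ℤ) * (x - q)
    factor = solve-∀

  Q-off-diagonal : ∀ {i j} → i ≢ j → Q i j ≡ common i j + E i j * (+ q - e i - e j)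
  Q-off-diagonal {i} {j} i≢j = trans (Q-cells i j) (trans
    (cong (λ d → common i j + d * (e i * e i - + q * e i) + E i j * (+ q - e i - e j)) (δ-≢ i≢j))
    (drop (common i j) (e i * e i - + q * e i) (E i j * (+ q - e i - e j))))
    where
    drop : ∀ a b c → a + 0ℤ * b + c ≡ a + c
    drop = solve-∀

  -- The factored diagonal entries give the cell sizes. At an edge only `common` survives; being a
  -- sum of non-negative terms it vanishes termwise, so the ends of an edge have no common
  -- non-neighbour, which is transitivity.
  Q≡0⇒clustered : (∀ i j → Q i j ≡ 0ℤ) → Clustered G q
  Q≡0⇒clustered Q≡0 = record { ≁-trans = λ {i} {j} {k} → ≁-trans i j k ; cell-size = cell-size }
    where
    cell-size : ∀ i → cell i ≡ 1 ⊎ cell i ≡ q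
    cell-size i = [ (λ eq → inj₁ (ℤ.+-injective (ℤ.i-j≡0⇒i≡j (e i) 1ℤ eq)))
                  , (λ eq → inj₂ (ℤ.+-injective (ℤ.i-j≡0⇒i≡j (e i) (+ q) eq))) ]′
      (ℤ.i*j≡0⇒i≡0∨j≡0 (e i - 1ℤ) {e i - + q} (trans (sym (Q-diagonal i)) (Q≡0 i i)))

    ≁-trans : ∀ i j k → ¬ (i ~ j) → ¬ (j ~ k) → ¬ (i ~ k)
    ≁-trans i j k i≁j j≁k i~k = 1≢0 (trans (sym (cong₂ _*_ (E-yes i≁j) (E-yes k≁j))) (∑≡0⇒≡0 0≤E*E common≡0 j))
      where
      1≢0 : 1ℤ ≢ 0ℤ
      1≢0 ()
      k≁j : ¬ (k ~ j)
      k≁j k~j = j≁k (~-sym k~j)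
      0≤E*E : ∀ l → 0ℤ ≤ℤ E i l * E k l
      0≤E*E l = 0≤⟦⟧*⟦⟧ (cell? i l) (cell? k l)
      common≡0 : common i k ≡ 0ℤ
      common≡0 = begin
        common i k                                       ≡⟨ drop (common i k) (+ q - e i - e k) ⟩
        common i k + 0ℤ * (+ q - e i - e k)              ≡⟨ cong (λ z → common i k + z * (+ q - e i - e k)) (E-no i~k) ⟨
        common i k + E i k * (+ q - e i - e k)           ≡⟨ Q-off-diagonal (λ { refl → ~-irr i i~k }) ⟨
        Q i k                                            ≡⟨ Q≡0 i k ⟩
        0ℤ                                               ∎
        where
        open ≡-Reasoning
        drop : ∀ a b → a ≡ a + 0ℤ * b
        drop = solve-∀

  -- Adjacent vertices have disjoint cells, so both terms of the entry vanish. Distinct non-adjacent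
  -- vertices share a cell of size `q`, and the entry is q + (q - q - q).
  clustered⇒Q≡0 : Clustered G q → (∀ {i j} → i ≢ j → ¬ (i ~ j) → cell i ≡ q) → ∀ i j → Q i j ≡ 0ℤ
  clustered⇒Q≡0 clustered nontrivial i j = cases (i Fin.≟ j) (i ~? j)
    where
    open Clustered clustered
    open ≡-Reasoning

    diagonal≡0 : ∀ i → cell i ≡ 1 ⊎ cell i ≡ q → (e i - 1ℤ) * (e i - + q) ≡ 0ℤ
    diagonal≡0 i (inj₁ eq) = trans (cong (λ z → (+ z - 1ℤ) * (e i - + q)) eq) (ℤ.*-zeroˡ (e i - + q))
    diagonal≡0 i (inj₂ eq) = trans (cong (λ z → (e i - 1ℤ) * (+ z - + q)) eq) (zero-factor (e i - 1ℤ) (+ q))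
      where
      zero-factor : ∀ a b → a * (b - b) ≡ 0ℤ
      zero-factor = solve-∀

    disjoint : i ~ j → ∀ k → E i k * E j k ≡ 0ℤ
    disjoint i~j k = product (cell? i k) (cell? j k)
      where
      product : (P? : Dec (¬ (i ~ k))) (Q? : Dec (¬ (j ~ k))) → ⟦ P? ⟧ * ⟦ Q? ⟧ ≡ 0ℤ
      product (yes i≁k) (yes j≁k) = ⊥-elim (≁-trans i≁k (λ k~j → j≁k (~-sym k~j)) i~j)
      product (yes _)   (no  _)   = refl
      product (no  _)   (yes _)   = refl
      product (no  _)   (no  _)   = refl

    same : ¬ (i ~ j) → ∀ k → E i k ≡ E j k
    same i≁j k = ⟦⟧-⇔ (cell? i k) (cell? j k) (≁-trans λ j~i → i≁j (~-sym j~i)) (≁-trans i≁j)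

    cancel : ∀ q → q + 1ℤ * (q - q - q) ≡ 0ℤ
    cancel = solve-∀

    cases : Dec (i ≡ j) → Dec (i ~ j) → Q i j ≡ 0ℤ
    cases (yes refl) _         = trans (Q-diagonal i) (diagonal≡0 i (cell-size i))
    cases (no  i≢j)  (yes i~j) = begin
      Q i j                                   ≡⟨ Q-off-diagonal i≢j ⟩
      common i j + E i j * (+ q - e i - e j)  ≡⟨ cong₂ (λ a b → a + b * (+ q - e i - e j)) (∑-0 (disjoint i~j)) (E-no i~j) ⟩
      0ℤ + 0ℤ * (+ q - e i - e j)             ≡⟨ trans (ℤ.+-identityˡ (0ℤ * (+ q - e i - e j))) (ℤ.*-zeroˡ (+ q - e i - e j)) ⟩
      0ℤ                                      ∎
    cases (no  i≢j)  (no i≁j)  = begin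
      Q i j
        ≡⟨ Q-off-diagonal i≢j ⟩
      common i j + E i j * (+ q - e i - e j)
        ≡⟨ cong₂ (λ a b → a + b * (+ q - e i - e j))
             (trans (∑-cong λ k → trans (cong (E i k *_) (sym (same i≁j k))) (⟦⟧-idem (cell? i k))) (∑E i)) (E-yes i≁j) ⟩
      e i + 1ℤ * (+ q - e i - e j)
        ≡⟨ cong₂ (λ a b → + a + 1ℤ * (+ q - + a - + b)) (nontrivial i≢j i≁j) (nontrivial (i≢j ∘ sym) λ j~i → i≁j (~-sym j~i)) ⟩
      + q + 1ℤ * (+ q - + q - + q)
        ≡⟨ cancel (+ q) ⟩
      0ℤ ∎

-- Reconstruction of the graph from its classes

index : ∀ {n ℓ} {P : U.Pred (Fin n) ℓ} (P? : U.Decidable P) i → P i → Fin (count P?)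
index P? zero    p with P? zero
... | yes _  = zero
... | no  ¬p = ⊥-elim (¬p p)
index P? (suc i) p with P? zero
... | yes _  = suc (index (P? ∘ suc) i p)
... | no  _  = index (P? ∘ suc) i p

-- `index` uses the proof of `P` only to refute an impossible branch, so the position is independent
-- of it.
index-cong : ∀ {n ℓ} {P : U.Pred (Fin n) ℓ} (P? : U.Decidable P) {i j} → i ≡ j → ∀ p q → index P? i p ≡ index P? j q
index-cong P? {zero}  refl p q with P? zero
... | yes _  = refl
... | no  ¬p = ⊥-elim (¬p p)
index-cong P? {suc i} refl p q with P? zero
... | yes _  = cong suc (index-cong (P? ∘ suc) {i} refl p q)
... | no  _  = index-cong (P? ∘ suc) {i} refl p q

index-injective : ∀ {n ℓ} {P : U.Pred (Fin n) ℓ} (P? : U.Decidable P) i j p q → index P? i p ≡ index P? j q → i ≡ j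
index-injective P? zero    zero    p q eq = refl
index-injective P? zero    (suc j) p q eq with P? zero
... | yes _  = ⊥-elim (Fin.0≢1+n eq)
... | no  ¬p = ⊥-elim (¬p p)
index-injective P? (suc i) zero    p q eq with P? zero
... | yes _  = ⊥-elim (Fin.0≢1+n (sym eq))
... | no  ¬p = ⊥-elim (¬p q)
index-injective P? (suc i) (suc j) p q eq with P? zero
... | yes _  = cong suc (index-injective (P? ∘ suc) i j p q (Fin.suc-injective eq))
... | no  _  = cong suc (index-injective (P? ∘ suc) i j p q eq)

count≡1⇒unique : ∀ {n ℓ} {P : U.Pred (Fin n) ℓ} (P? : U.Decidable P) → count P? ≡ 1 → ∀ {i j} → P i → P j → i ≡ j
count≡1⇒unique P? count≡1 {i} {j} p q = index-injective P? i j p q (unique count≡1 (index P? i p) (index P? j q))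
  where
  unique : ∀ {k} → k ≡ 1 → (x y : Fin k) → x ≡ y
  unique refl zero zero = refl

count-cong : ∀ {n ℓ₁ ℓ₂} {P : U.Pred (Fin n) ℓ₁} {Q : U.Pred (Fin n) ℓ₂} (P? : U.Decidable P) (Q? : U.Decidable Q) →
  (∀ i → P i → Q i) → (∀ i → Q i → P i) → count P? ≡ count Q?
count-cong P? Q? P⇒Q Q⇒P = ℤ.+-injective (trans (sym (∑-count P?))
  (trans (∑-cong λ i → ⟦⟧-⇔ (P? i) (Q? i) (P⇒Q i) (Q⇒P i)) (∑-count Q?)))

first : ∀ {n ℓ} {P : U.Pred (Fin n) ℓ} → U.Decidable P → ∃[ i ] P i → ∃[ i ] P i
first {suc n} P? (i , p) with P? zero
first {suc n} P? (i , p)     | yes p₀ = zero , p₀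
first {suc n} P? (zero , p)  | no ¬p₀ = ⊥-elim (¬p₀ p)
first {suc n} P? (suc i , p) | no _ with j , q ← first (P? ∘ suc) (i , p) = suc j , q

-- `first` returns the least witness, which depends on the extension of the predicate and not on the
-- witness supplied. This makes representatives constant on cells.
first-cong : ∀ {n ℓ₁ ℓ₂} {P : U.Pred (Fin n) ℓ₁} {Q : U.Pred (Fin n) ℓ₂} (P? : U.Decidable P) (Q? : U.Decidable Q) →
  (∀ i → P i → Q i) → (∀ i → Q i → P i) → ∀ p q → proj₁ (first P? p) ≡ proj₁ (first Q? q)
first-cong {suc n} P? Q? P⇒Q Q⇒P (i , p) (j , q) with P? zero | Q? zero
first-cong {suc n} P? Q? P⇒Q Q⇒P (i , p) (j , q)         | yes _  | yes _  = refl
first-cong {suc n} P? Q? P⇒Q Q⇒P (i , p) (j , q)         | yes p₀ | no ¬q₀ = ⊥-elim (¬q₀ (P⇒Q zero p₀))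
first-cong {suc n} P? Q? P⇒Q Q⇒P (i , p) (j , q)         | no ¬p₀ | yes q₀ = ⊥-elim (¬p₀ (Q⇒P zero q₀))
first-cong {suc n} P? Q? P⇒Q Q⇒P (zero , p) (j , q)      | no ¬p₀ | no ¬q₀ = ⊥-elim (¬p₀ p)
first-cong {suc n} P? Q? P⇒Q Q⇒P (suc i , p) (zero , q)  | no ¬p₀ | no ¬q₀ = ⊥-elim (¬q₀ q)
first-cong {suc n} P? Q? P⇒Q Q⇒P (suc i , p) (suc j , q) | no ¬p₀ | no ¬q₀ =
  cong suc (first-cong (P? ∘ suc) (Q? ∘ suc) (P⇒Q ∘ suc) (Q⇒P ∘ suc) (i , p) (j , q))

injective⇒surjective : ∀ {m n} → m ≡ n → (f : Fin m → Fin n) → (∀ i j → f i ≡ f j → i ≡ j) → ∀ y → ∃[ x ] f x ≡ y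
injective⇒surjective {suc n} refl f f-inj y with Fin.any? (λ x → f x Fin.≟ y)
... | yes hit = hit
... | no ¬hit = ⊥-elim (ℕ.1+n≰n (Fin.injective⇒≤ {f = λ x → punchOut (miss x)}
  λ {i} {j} eq → f-inj i j (Fin.punchOut-injective (miss i) (miss j) eq)))
  where
  miss : ∀ x → y ≢ f x
  miss x y≡fx = ¬hit (x , sym y≡fx)

injective⇒↔ : ∀ {m n} → m ≡ n → (f : Fin m → Fin n) → (∀ i j → f i ≡ f j → i ≡ j) → Fin m ↔ Fin n
injective⇒↔ m≡n f f-inj = mk↔ₛ′ f (proj₁ ∘ surj) (proj₂ ∘ surj) (λ x → f-inj _ x (proj₂ (surj (f x))))
  where surj = injective⇒surjective m≡n f f-inj

∑-⊎ : ∀ m {n} (f : Fin (m ℕ.+ n) → ℤ) → ∑ f ≡ ∑ (λ i → f (i ↑ˡ n)) + ∑ (λ j → f (m ↑ʳ j))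
∑-⊎ zero    f = trans (sym (ℤ.+-identityˡ (∑ f))) (cong (_+ ∑ f) (sym (∑-[] _)))
∑-⊎ (suc m) f = trans (∑-∷ f) (trans (cong (λ z → f zero + z) (∑-⊎ m (f ∘ suc))) (trans
  (sym (ℤ.+-assoc (f zero) _ _)) (cong (_+ ∑ (λ j → f (suc m ↑ʳ j))) (sym (∑-∷ λ i → f (i ↑ˡ _))))))

∑-combine : ∀ m {n} (f : Fin (m ℕ.* n) → ℤ) → ∑ f ≡ ∑ λ i → ∑ λ j → f (combine {m} {n} i j)
∑-combine zero        f = trans (∑-[] f) (sym (∑-[] _))
∑-combine (suc m) {n} f = trans (∑-⊎ n f) (trans (cong (λ z → ∑ (λ j → f (j ↑ˡ (m ℕ.* n))) + z) (∑-combine m λ j → f (n ↑ʳ j)))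
  (sym (∑-∷ λ i → ∑ λ j → f (combine {suc m} {n} i j))))

∑-cast : ∀ {m n} (eq : m ≡ n) (f : Fin n → ℤ) → ∑ f ≡ ∑ λ i → f (cast eq i)
∑-cast refl f = ∑-cong λ i → cong f (sym (Fin.cast-is-id refl i))

-- Complete multipartite graphs and their cones

-- There are `p` parts of size `q`, and `pick i j` is vertex number `i` of part `j`. That each
-- vertex is picked exactly once is expressed as a reindexing of sums, the form in which cells are
-- counted.
record Multipartite {n} (U : Graph n) (p q : ℕ) : Set where
  open Graph U
  field
    part      : Fin n → Fin p
    ≁⇒part≡   : ∀ {x y} → ¬ (x ~ y) → part x ≡ part y
    part≡⇒≁   : ∀ {x y} → part x ≡ part y → ¬ (x ~ y)
    pick      : Fin q → Fin p → Fin n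
    part-pick : ∀ i j → part (pick i j) ≡ j
    pick-inj  : ∀ i i′ j → pick i j ≡ pick i′ j → i ≡ i′
    ∑-pick    : ∀ f → ∑ f ≡ ∑ λ i → ∑ λ j → f (pick i j)

  size : n ≡ q ℕ.* p
  size = ℤ.+-injective (begin
    + n                                        ≡⟨ ℤ.*-identityʳ (+ n) ⟨
    + n * 1ℤ                                   ≡⟨ ∑-const n 1ℤ ⟨
    ∑ {n} (λ _ → 1ℤ)                           ≡⟨ ∑-pick (λ _ → 1ℤ) ⟩
    ∑ {q} (λ _ → ∑ {p} λ _ → 1ℤ)               ≡⟨ trans (∑-cong {q} λ _ → trans (∑-const p 1ℤ) (ℤ.*-identityʳ (+ p))) (∑-const q (+ p)) ⟩
    + q * + p                                  ≡⟨ ℤ.pos-* q p ⟨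
    + (q ℕ.* p)                                ∎)
    where open ≡-Reasoning

module Cone (v : ℕ) {n} (U : Graph n) {p q} (multipartite : Multipartite U p q) where
  open Multipartite multipartite

  G : Graph (v ℕ.+ n)
  G = complete v ▽ U

  open Graph G
  open Cells G
  open Join (complete v) U using (Adj) public

  ~-join : ∀ s t → join v n s ~ join v n t → Adj s t
  ~-join s t = subst₂ Adj (Fin.splitAt-join v n s) (Fin.splitAt-join v n t)

  join-~ : ∀ s t → Adj s t → join v n s ~ join v n t
  join-~ s t = subst₂ Adj (sym (Fin.splitAt-join v n s)) (sym (Fin.splitAt-join v n t))

  ∑-δ-1 : ∀ {k} (i : Fin k) → ∑ (δ i) ≡ 1ℤ
  ∑-δ-1 i = trans (∑-cong λ j → sym (ℤ.*-identityʳ (δ i j))) (∑-δ i λ _ → 1ℤ)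

  cell-join : Fin v ⊎ Fin n → ℕ
  cell-join (inj₁ _) = 1
  cell-join (inj₂ _) = q

  cell-▽ : ∀ s → cell (join v n s) ≡ cell-join s
  cell-▽ (inj₁ a) = ℤ.+-injective (begin
    e (a ↑ˡ n)                                                        ≡⟨ ∑E (a ↑ˡ n) ⟨
    ∑ (E (a ↑ˡ n))                                                    ≡⟨ ∑-⊎ v _ ⟩
    ∑ (λ b → E (a ↑ˡ n) (b ↑ˡ n)) + ∑ (λ y → E (a ↑ˡ n) (v ↑ʳ y))     ≡⟨ cong₂ _+_ (trans (∑-cong left) (∑-δ-1 a)) (∑-0 right) ⟩
    1ℤ                                                                ∎)
    where
    open ≡-Reasoning
    left : ∀ b → E (a ↑ˡ n) (b ↑ˡ n) ≡ δ a b
    left b = ⟦⟧-⇔ (cell? (a ↑ˡ n) (b ↑ˡ n)) (a Fin.≟ b)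
      (λ i≁j → decidable-stable (a Fin.≟ b) λ a≢b → i≁j (join-~ (inj₁ a) (inj₁ b) a≢b))
      (λ a≡b adj → ~-join (inj₁ a) (inj₁ b) adj a≡b)
    right : ∀ y → E (a ↑ˡ n) (v ↑ʳ y) ≡ 0ℤ
    right y = ⟦⟧-no (cell? (a ↑ˡ n) (v ↑ʳ y)) λ i≁j → i≁j (join-~ (inj₁ a) (inj₂ y) tt)
  cell-▽ (inj₂ x) = ℤ.+-injective (begin
    e (v ↑ʳ x)                                                        ≡⟨ ∑E (v ↑ʳ x) ⟨
    ∑ (E (v ↑ʳ x))                                                    ≡⟨ ∑-⊎ v _ ⟩
    ∑ (λ b → E (v ↑ʳ x) (b ↑ˡ n)) + ∑ (λ y → E (v ↑ʳ x) (v ↑ʳ y))     ≡⟨ cong₂ _+_ (∑-0 left) (∑-cong right) ⟩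
    0ℤ + ∑ (λ y → δ (part x) (part y))                                ≡⟨ trans (ℤ.+-identityˡ _) (∑-pick _) ⟩
    ∑ (λ i → ∑ λ j → δ (part x) (part (pick i j)))
      ≡⟨ (∑-cong λ i → trans (∑-cong λ j → cong (δ (part x)) (part-pick i j)) (∑-δ-1 (part x))) ⟩
    ∑ {q} (λ i → 1ℤ)                                                  ≡⟨ trans (∑-const q 1ℤ) (ℤ.*-identityʳ (+ q)) ⟩
    + q                                                               ∎)
    where
    open ≡-Reasoning
    left : ∀ b → E (v ↑ʳ x) (b ↑ˡ n) ≡ 0ℤ
    left b = ⟦⟧-no (cell? (v ↑ʳ x) (b ↑ˡ n)) λ i≁j → i≁j (join-~ (inj₂ x) (inj₁ b) tt)
    right : ∀ y → E (v ↑ʳ x) (v ↑ʳ y) ≡ δ (part x) (part y)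
    right y = ⟦⟧-⇔ (cell? (v ↑ʳ x) (v ↑ʳ y)) (part x Fin.≟ part y)
      (λ i≁j → ≁⇒part≡ λ x~y → i≁j (join-~ (inj₂ x) (inj₂ y) x~y))
      (λ eq adj → part≡⇒≁ eq (~-join (inj₂ x) (inj₂ y) adj))

  cell-splitAt : ∀ i → cell i ≡ cell-join (splitAt v i)
  cell-splitAt i = trans (cong cell (sym (Fin.join-splitAt v n i))) (cell-▽ (splitAt v i))

  clustered : Clustered G q
  clustered = record
    { ≁-trans   = λ {i} {j} {k} → ≁-trans (splitAt v i) (splitAt v j) (splitAt v k)
    ; cell-size = λ i → subst (λ z → z ≡ 1 ⊎ z ≡ q) (sym (cell-splitAt i)) (size-join (splitAt v i))
    }
    where
    size-join : ∀ s → cell-join s ≡ 1 ⊎ cell-join s ≡ q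
    size-join (inj₁ _) = inj₁ refl
    size-join (inj₂ _) = inj₂ refl
    ≁-trans : ∀ s t u → ¬ Adj s t → ¬ Adj t u → ¬ Adj s u
    -- Non-adjacency in `complete v` is a doubly negated equality, so transitivity is chained under
    -- the negations.
    ≁-trans (inj₁ a) (inj₁ b) (inj₁ c) s≁t t≁u a≢c = s≁t λ a≡b → t≁u λ b≡c → a≢c (trans a≡b b≡c)
    ≁-trans (inj₁ a) (inj₁ b) (inj₂ z) s≁t t≁u _ = t≁u tt
    ≁-trans (inj₁ a) (inj₂ y) u        s≁t t≁u _ = s≁t tt
    ≁-trans (inj₂ x) (inj₁ b) u        s≁t t≁u _ = s≁t tt
    ≁-trans (inj₂ x) (inj₂ y) (inj₁ c) s≁t t≁u _ = t≁u tt
    ≁-trans (inj₂ x) (inj₂ y) (inj₂ z) s≁t t≁u = part≡⇒≁ (trans (≁⇒part≡ s≁t) (≁⇒part≡ t≁u))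

  nontrivial-cell : ∀ {i j} → i ≢ j → ¬ (i ~ j) → cell i ≡ q
  nontrivial-cell {i} {j} i≢j i≁j = trans (cell-splitAt i) (big (splitAt v i) (splitAt v j) (i≢j ∘ splitAt-inj) i≁j)
    where
    splitAt-inj : splitAt v i ≡ splitAt v j → i ≡ j
    splitAt-inj eq = trans (sym (Fin.join-splitAt v n i)) (trans (cong (join v n) eq) (Fin.join-splitAt v n j))
    big : ∀ s t → s ≢ t → ¬ Adj s t → cell-join s ≡ q
    big (inj₁ a) (inj₁ b) s≢t s≁t = ⊥-elim (s≁t (s≢t ∘ cong inj₁))
    big (inj₁ a) (inj₂ y) s≢t s≁t = ⊥-elim (s≁t tt)
    big (inj₂ x) t        s≢t s≁t = refl

  ∑-cell : ∑ e ≡ + (v ℕ.+ n ℕ.* q)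
  ∑-cell = begin
    ∑ e                                                ≡⟨ ∑-⊎ v e ⟩
    ∑ (λ a → e (a ↑ˡ n)) + ∑ (λ x → e (v ↑ʳ x))        ≡⟨ cong₂ _+_
                                                            (trans (∑-cong λ a → cong +_ (cell-▽ (inj₁ a))) (trans (∑-const v 1ℤ) (ℤ.*-identityʳ (+ v))))
                                                            (trans (∑-cong λ x → cong +_ (cell-▽ (inj₂ x))) (∑-const n (+ q))) ⟩
    + v + + n * + q                                    ≡⟨ cong (λ z → + v + z) (ℤ.pos-* n q) ⟨
    + (v ℕ.+ n ℕ.* q)                                  ∎
    where open ≡-Reasoning

⟦⟧-× : ∀ {p r} {P : Set p} {R : Set r} (P? : Dec P) (R? : Dec R) → ⟦ P? ×-dec R? ⟧ ≡ ⟦ P? ⟧ * ⟦ R? ⟧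
⟦⟧-× (yes _) (yes _) = refl
⟦⟧-× (yes _) (no  _) = refl
⟦⟧-× (no  _) (yes _) = refl
⟦⟧-× (no  _) (no  _) = refl

-- Counting and matching the classes

module Representatives {k} (H : Graph k) {q} (clustered : Clustered H q) where
  open Graph H
  open Cells H
  open Clustered clustered

  ≁-sym : ∀ {i j} → ¬ (i ~ j) → ¬ (j ~ i)
  ≁-sym i≁j j~i = i≁j (~-sym j~i)

  cell-cong : ∀ {i j} → ¬ (i ~ j) → cell i ≡ cell j
  cell-cong {i} {j} i≁j = count-cong (cell? i) (cell? j) (λ _ → ≁-trans (≁-sym i≁j)) (λ _ → ≁-trans i≁j)

  -- The least vertex of the cell names it canonically: two vertices are non-adjacent exactly when
  -- their `rep` agree.
  rep : Fin k → Fin k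
  rep i = proj₁ (first (cell? i) (i , ~-irr i))

  ≁-rep : ∀ i → ¬ (i ~ rep i)
  ≁-rep i = proj₂ (first (cell? i) (i , ~-irr i))

  rep-cong : ∀ {i j} → ¬ (i ~ j) → rep i ≡ rep j
  rep-cong {i} {j} i≁j = first-cong (cell? i) (cell? j) (λ _ → ≁-trans (≁-sym i≁j)) (λ _ → ≁-trans i≁j) _ _

  rep≡⇒≁ : ∀ {i j} → rep i ≡ rep j → ¬ (i ~ j)
  rep≡⇒≁ {i} {j} eq = ≁-trans (≁-rep i) (≁-sym (subst (λ r → ¬ (j ~ r)) (sym eq) (≁-rep j)))

  rep-idem : ∀ i → rep (rep i) ≡ rep i
  rep-idem i = sym (rep-cong (≁-rep i))

  small? : U.Decidable (λ i → cell i ≡ 1)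
  small? i = cell i ℕ.≟ 1

  big? : U.Decidable (λ i → ¬ (cell i ≡ 1))
  big? i = ¬? (small? i)

  big-cell : ∀ {i} → ¬ (cell i ≡ 1) → cell i ≡ q
  big-cell {i} big = [ (λ small → ⊥-elim (big small)) , (λ eq → eq) ]′ (cell-size i)

  Rep : Fin k → Set
  Rep j = rep j ≡ j × ¬ (cell j ≡ 1)

  Rep? : U.Decidable Rep
  Rep? j = (rep j Fin.≟ j) ×-dec big? j

  rep-Rep : ∀ {i} → ¬ (cell i ≡ 1) → Rep (rep i)
  rep-Rep {i} big = rep-idem i , λ small → big (trans (cell-cong (≁-rep i)) small)

  ∑-cells : ∑ e ≡ + k + + count big? * (+ q - 1ℤ)
  ∑-cells = begin
    ∑ e                                                ≡⟨ ∑-cong (λ i → term i (small? i)) ⟩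
    ∑ (λ i → 1ℤ + ⟦ big? i ⟧ * (+ q - 1ℤ))             ≡⟨ ∑-+ {k} (λ _ → 1ℤ) (λ i → ⟦ big? i ⟧ * (+ q - 1ℤ)) ⟩
    ∑ {k} (λ _ → 1ℤ) + ∑ (λ i → ⟦ big? i ⟧ * (+ q - 1ℤ))
      ≡⟨ cong₂ _+_ (trans (∑-const k 1ℤ) (ℤ.*-identityʳ (+ k)))
           (trans (∑-*ʳ (λ i → ⟦ big? i ⟧) (+ q - 1ℤ)) (cong (_* (+ q - 1ℤ)) (∑-count big?))) ⟩
    + k + + count big? * (+ q - 1ℤ)                    ∎
    where
    open ≡-Reasoning
    add : ∀ a → a ≡ 1ℤ + 1ℤ * (a - 1ℤ)
    add = solve-∀
    term : ∀ i (s? : Dec (cell i ≡ 1)) → e i ≡ 1ℤ + ⟦ ¬? s? ⟧ * (+ q - 1ℤ)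
    term i (yes small) = trans (cong +_ small) (sym (trans (cong (λ z → 1ℤ + z) (ℤ.*-zeroˡ (+ q - 1ℤ))) (ℤ.+-identityʳ 1ℤ)))
    term i (no  big)   = trans (cong +_ (big-cell big)) (add (+ q))

  count-small : + count small? ≡ + k - + count big?
  count-small = begin
    + count small?                       ≡⟨ ∑-count small? ⟨
    ∑ (λ i → ⟦ small? i ⟧)               ≡⟨ (∑-cong λ i → trans (⟦⟧-¬ (small? i)) (cong (λ z → 1ℤ + z) (sym (ℤ.-1*i≡-i ⟦ big? i ⟧)))) ⟩
    ∑ (λ i → 1ℤ + -1ℤ * ⟦ big? i ⟧)      ≡⟨ ∑-+ {k} (λ _ → 1ℤ) (λ i → -1ℤ * ⟦ big? i ⟧) ⟩
    ∑ {k} (λ _ → 1ℤ) + ∑ (λ i → -1ℤ * ⟦ big? i ⟧)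
      ≡⟨ cong₂ _+_ (trans (∑-const k 1ℤ) (ℤ.*-identityʳ (+ k)))
           (trans (∑-*ˡ -1ℤ (λ i → ⟦ big? i ⟧)) (trans (cong (-1ℤ *_) (∑-count big?)) (ℤ.-1*i≡-i (+ count big?)))) ⟩
    + k - + count big?                   ∎
    where open ≡-Reasoning

  -- Count the pairs (i , rep i) with i in a cell of size q.
  count-big : count big? ≡ count Rep? ℕ.* q
  count-big = ℤ.+-injective (begin
    + count big?                               ≡⟨ ∑-count big? ⟨
    ∑ (λ i → ⟦ big? i ⟧)                       ≡⟨ ∑-cong by-rep ⟨
    ∑ (λ i → ∑ λ j → ⟦ pair? i j ⟧)            ≡⟨ ∑-comm _ ⟩
    ∑ (λ j → ∑ λ i → ⟦ pair? i j ⟧)            ≡⟨ ∑-cong (λ j → by-cell j (Rep? j)) ⟩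
    ∑ (λ j → ⟦ Rep? j ⟧ * + q)                 ≡⟨ trans (∑-*ʳ (λ j → ⟦ Rep? j ⟧) (+ q)) (cong (_* + q) (∑-count Rep?)) ⟩
    + count Rep? * + q                         ≡⟨ ℤ.pos-* (count Rep?) q ⟨
    + (count Rep? ℕ.* q)                       ∎)
    where
    open ≡-Reasoning
    pair? : ∀ i j → Dec (rep i ≡ j × ¬ (cell i ≡ 1))
    pair? i j = (rep i Fin.≟ j) ×-dec big? i
    by-rep : ∀ i → ∑ (λ j → ⟦ pair? i j ⟧) ≡ ⟦ big? i ⟧
    by-rep i = trans (∑-cong λ j → ⟦⟧-× (rep i Fin.≟ j) (big? i)) (∑-δ (rep i) λ _ → ⟦ big? i ⟧)
    by-cell : ∀ j (r? : Dec (Rep j)) → ∑ (λ i → ⟦ pair? i j ⟧) ≡ ⟦ r? ⟧ * + q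
    by-cell j (yes (rep-j , big)) = begin
      ∑ (λ i → ⟦ pair? i j ⟧)  ≡⟨ (∑-cong λ i → ⟦⟧-⇔ (pair? i j) (cell? j i)
                                    (λ (rep-i , _) → rep≡⇒≁ (trans rep-j (sym rep-i)))
                                    (λ j≁i → trans (sym (rep-cong j≁i)) rep-j , λ small → big (trans (cell-cong j≁i) small))) ⟩
      ∑ (E j)                  ≡⟨ ∑E j ⟩
      e j                      ≡⟨ cong +_ (big-cell big) ⟩
      + q                      ≡⟨ ℤ.*-identityˡ (+ q) ⟨
      1ℤ * + q                 ∎
    by-cell j (no ¬Rep) = trans
      (∑-0 λ i → ⟦⟧-no (pair? i j) λ (rep-i , big) → ¬Rep (subst Rep rep-i (rep-Rep big)))
      (sym (ℤ.*-zeroˡ (+ q)))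

module Isomorphism (v : ℕ) {n} (U : Graph n) {p q} .{{_ : ℕ.NonZero q}} (multipartite : Multipartite U p q)
  {k} (H : Graph k) (H-clustered : Clustered H q)
  (k≡v+n : k ≡ v ℕ.+ n) (∑e≡ : ∑ (Cells.e H) ≡ + (v ℕ.+ n ℕ.* q)) where

  open Multipartite multipartite
  open Cone v U multipartite using (G; Adj; ~-join; join-~)
  open Graph H
  open Cells H
  open Representatives H H-clustered

  module _ (q≢1 : q ≢ 1) where

    -- Let b be `count big?`. The two values of the sum of cell sizes give k + b (q - 1) = v + n q,
    -- and k = v + n turns this into (b - n) (q - 1) = 0.
    count-big≡n : count big? ≡ n
    count-big≡n = [ (λ eq → ℤ.+-injective (ℤ.i-j≡0⇒i≡j (+ count big?) (+ n) eq))
                  , (λ eq → ⊥-elim (q≢1 (ℤ.+-injective (ℤ.i-j≡0⇒i≡j (+ q) 1ℤ eq)))) ]′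
      (ℤ.i*j≡0⇒i≡0∨j≡0 (+ count big? - + n) {+ q - 1ℤ} (begin
        (+ count big? - + n) * (+ q - 1ℤ)
          ≡⟨ rearrange (+ count big?) (+ v) (+ n) (+ q) ⟩
        ((+ v + + n) + + count big? * (+ q - 1ℤ)) - (+ v + + n * + q)
          ≡⟨ cong₂ (λ a b → (a + + count big? * (+ q - 1ℤ)) - (+ v + b)) (cong +_ k≡v+n) (ℤ.pos-* n q) ⟨
        (+ k + + count big? * (+ q - 1ℤ)) - + (v ℕ.+ n ℕ.* q)
          ≡⟨ ℤ.i≡j⇒i-j≡0 (trans (sym ∑-cells) ∑e≡) ⟩
        0ℤ ∎))
      where
      open ≡-Reasoning
      rearrange : ∀ b v n q → (b - n) * (q - 1ℤ) ≡ ((v + n) + b * (q - 1ℤ)) - (v + n * q)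
      rearrange = solve-∀

    count-small≡v : count small? ≡ v
    count-small≡v = ℤ.+-injective (trans count-small (trans
      (cong₂ (λ a b → + a - + b) k≡v+n count-big≡n) (cancel (+ v) (+ n))))
      where
      cancel : ∀ a b → (a + b) - b ≡ a
      cancel = solve-∀

    count-Rep≡p : count Rep? ≡ p
    count-Rep≡p = ℕ.*-cancelʳ-≡ (count Rep?) p q (trans (sym count-big) (trans count-big≡n (trans size (ℕ.*-comm q p))))

    -- The position of `i` in its cell. The representative `r` is a variable, so that in
    -- `rank-injective` an equation between two representatives can be matched with `refl`.
    rank : ∀ {i} r → ¬ (r ~ i) → ¬ (cell i ≡ 1) → Fin q
    rank {i} r r≁i big = cast (trans (cell-cong r≁i) (big-cell big)) (index (cell? r) i r≁i)

    class : ∀ {i} → ¬ (cell i ≡ 1) → Fin p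
    class {i} big = cast count-Rep≡p (index Rep? (rep i) (rep-Rep big))

    -- Vertices in singleton cells go to the complete part; the others are placed by class and by
    -- rank within it. The decision is an argument, so later proofs can split on it directly.
    label : ∀ i → Dec (cell i ≡ 1) → Fin v ⊎ Fin n
    label i (yes small) = inj₁ (cast count-small≡v (index small? i small))
    label i (no  big)   = inj₂ (pick (rank (rep i) (≁-sym (≁-rep i)) big) (class big))

    cast-injective : ∀ {a b} .(eq : a ≡ b) (x y : Fin a) → cast eq x ≡ cast eq y → x ≡ y
    cast-injective eq x y cx≡cy = Fin.toℕ-injective (trans (sym (Fin.toℕ-cast eq x)) (trans (cong toℕ cx≡cy) (Fin.toℕ-cast eq y)))

    class-injective : ∀ {i j} (bᵢ : ¬ (cell i ≡ 1)) (bⱼ : ¬ (cell j ≡ 1)) → class bᵢ ≡ class bⱼ → rep i ≡ rep j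
    class-injective {i} {j} bᵢ bⱼ eq = index-injective Rep? (rep i) (rep j) _ _ (cast-injective count-Rep≡p _ _ eq)

    class-cong : ∀ {i j} (bᵢ : ¬ (cell i ≡ 1)) (bⱼ : ¬ (cell j ≡ 1)) → rep i ≡ rep j → class bᵢ ≡ class bⱼ
    class-cong bᵢ bⱼ eq = cong (cast count-Rep≡p) (index-cong Rep? eq _ _)

    rank-injective : ∀ {i j r r′} → r ≡ r′ → (r≁i : ¬ (r ~ i)) (r′≁j : ¬ (r′ ~ j)) (bᵢ : ¬ (cell i ≡ 1)) (bⱼ : ¬ (cell j ≡ 1)) →
      rank r r≁i bᵢ ≡ rank r′ r′≁j bⱼ → i ≡ j
    rank-injective {i} {j} {r} refl r≁i r≁j bᵢ bⱼ eq = index-injective (cell? r) i j r≁i r≁j (cast-injective _ _ _ eq)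

    pick-class : ∀ {a b c d} → pick a b ≡ pick c d → b ≡ d
    pick-class {a} {b} {c} {d} eq = trans (sym (part-pick a b)) (trans (cong part eq) (part-pick c d))

    label-injective : ∀ i j s t → label i s ≡ label j t → i ≡ j
    label-injective i j (yes s) (yes t) eq = index-injective small? i j s t (cast-injective count-small≡v _ _ (inj₁-injective eq))
    label-injective i j (no  s) (no  t) eq = rank-injective (class-injective s t classes) _ _ s t
      -- `pick-inj` compares two picks from one part, so the class of `j` is first replaced by that
      -- of `i`.
      (pick-inj _ _ (class s) (trans picks (cong (pick _) (sym classes))))
      where
      picks = inj₂-injective eq
      classes = pick-class picks

    ≁⇒label : ∀ i j s t → ¬ (i ~ j) → ¬ Adj (label i s) (label j t)
    ≁⇒label i j (yes s) (yes t) i≁j = λ adj → adj (cong (cast count-small≡v)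
      (index-cong small? (count≡1⇒unique (cell? i) s (~-irr i) i≁j) s t))
    ≁⇒label i j (yes s) (no  t) i≁j = λ _ → t (trans (sym (cell-cong i≁j)) s)
    ≁⇒label i j (no  s) (yes t) i≁j = λ _ → s (trans (cell-cong i≁j) t)
    ≁⇒label i j (no  s) (no  t) i≁j = part≡⇒≁ (trans (part-pick _ _) (trans (class-cong s t (rep-cong i≁j)) (sym (part-pick _ _))))

    label⇒≁ : ∀ i j s t → ¬ Adj (label i s) (label j t) → ¬ (i ~ j)
    label⇒≁ i j (yes s) (yes t) ≁ i~j = ≁ λ eq → ~-irr i (subst (i ~_) (sym (label-injective i j (yes s) (yes t) (cong inj₁ eq))) i~j)
    label⇒≁ i j (yes s) (no  t) ≁ _ = ≁ tt
    label⇒≁ i j (no  s) (yes t) ≁ _ = ≁ tt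
    label⇒≁ i j (no  s) (no  t) ≁ = rep≡⇒≁ (class-injective s t (trans (sym (part-pick _ _)) (trans (≁⇒part≡ ≁) (part-pick _ _))))

    large-iso : H ≅ G
    large-iso = injective⇒↔ k≡v+n f (λ i j eq → label-injective i j (small? i) (small? j)
        (trans (sym (Fin.splitAt-join v n _)) (trans (cong (splitAt v) eq) (Fin.splitAt-join v n _)))) ,
      λ i j → mk⇔
        -- The labels are known to preserve and reflect non-adjacency; decidability of both graphs
        -- turns this into a statement about adjacency.
        (λ i~j → decidable-stable (Graph._~?_ G (f i) (f j)) λ f≁ → label⇒≁ i j (small? i) (small? j) (λ adj → f≁ (join-~ (g i) (g j) adj)) i~j)
        (λ f~ → decidable-stable (i ~? j) λ i≁j → ≁⇒label i j (small? i) (small? j) i≁j (~-join (g i) (g j) f~))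
      where
      g : Fin k → Fin v ⊎ Fin n
      g i = label i (small? i)
      f : Fin k → Fin (v ℕ.+ n)
      f i = join v n (g i)

complete-cells : ∀ {n} (G : Graph n) → (∀ i → Cells.cell G i ≡ 1) → let open Graph G in ∀ i j → i ≢ j → i ~ j
complete-cells G cell≡1 i j i≢j = decidable-stable (i ~? j) λ i≁j →
  i≢j (count≡1⇒unique (Cells.cell? G i) (cell≡1 i) (~-irr i) i≁j)
  where open Graph G

-- Used for `q ≡ 1`: singleton cells make both graphs complete, so the identity on vertices is an
-- isomorphism.
complete-iso : ∀ {m n} (G : Graph m) (H : Graph n) → m ≡ n →
  (∀ i → Cells.cell G i ≡ 1) → (∀ i → Cells.cell H i ≡ 1) → G ≅ H
complete-iso G H refl cellG cellH = ↔-id _ , λ i j → mk⇔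
  (λ i~j → complete-cells H cellH i j λ { refl → Graph.~-irr G i i~j })
  (λ i~j → complete-cells G cellG i j λ { refl → Graph.~-irr H i i~j })

-- Unitary Cayley graphs of prime power order

-- A common divisor of `a` and the power is coprime to `p`, because `p` does not divide `a`; the
-- factors `p` can then be stripped off one by one.
∤⇒coprime-^ : ∀ {p} → Prime p → ∀ {a} → ¬ (p ∣ a) → ∀ m → Coprime a (p ℕ.^ m)
∤⇒coprime-^ {p} p-prime p∤a m {d} (d∣a , d∣pᵐ) = ∣1⇒≡1 (divides-1 m d∣pᵐ)
  where
  d-coprime-p : Coprime d p
  d-coprime-p (c∣d , c∣p) = [ (λ c≡1 → c≡1) , (λ { refl → ⊥-elim (p∤a (∣-trans c∣d d∣a)) }) ]′
    (prime⇒irreducible p-prime c∣p)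
  divides-1 : ∀ m → d ∣ p ℕ.^ m → d ∣ 1
  divides-1 zero    d∣ = d∣
  divides-1 (suc m) d∣ = divides-1 m (coprime-divisor d-coprime-p d∣)

m+n≡m[mod]⇒∣n : ∀ m n d .{{_ : ℕ.NonZero d}} → (m ℕ.+ n) ℕ.% d ≡ m ℕ.% d → d ∣ n
m+n≡m[mod]⇒∣n m n d eq = ∣m+n∣m⇒∣n {m = m ℕ./ d ℕ.* d} (divides ((m ℕ.+ n) ℕ./ d) (ℕ.+-cancelˡ-≡ (m ℕ.% d) _ _ (begin
  m ℕ.% d ℕ.+ (m ℕ./ d ℕ.* d ℕ.+ n)              ≡⟨ ℕ.+-assoc (m ℕ.% d) _ n ⟨
  m ℕ.% d ℕ.+ m ℕ./ d ℕ.* d ℕ.+ n                ≡⟨ cong (ℕ._+ n) (m≡m%n+[m/n]*n m d) ⟨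
  m ℕ.+ n                                        ≡⟨ m≡m%n+[m/n]*n (m ℕ.+ n) d ⟩
  (m ℕ.+ n) ℕ.% d ℕ.+ (m ℕ.+ n) ℕ./ d ℕ.* d      ≡⟨ cong (ℕ._+ (m ℕ.+ n) ℕ./ d ℕ.* d) eq ⟩
  m ℕ.% d ℕ.+ (m ℕ.+ n) ℕ./ d ℕ.* d              ∎))) (divides (m ℕ./ d) refl)
  where open ≡-Reasoning

module PrimePower {p} (p-prime : Prime p) (m : ℕ) where
  private
    q n : ℕ
    q = p ℕ.^ m
    n = p ℕ.^ suc m
    instance
      p-nonZero : ℕ.NonZero p
      p-nonZero = prime⇒nonZero p-prime
      n-nonTrivial : ℕ.NonTrivial n
      n-nonTrivial = primePower-nonTrivial {p} {suc m} p-prime (s≤s z≤n)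
      n-nonZero : ℕ.NonZero n
      n-nonZero = ℕ.nonTrivial⇒nonZero n

  open IntegersMod n using (_⊕_; ⊖_; toℕ-mod; ⊕-assoc; ⊕-comm; ⊕-identityˡ; ⊕-inverseˡ)

  Γ : Graph n
  Γ = unitaryCayley n

  open Graph Γ

  p∣n : p ∣ n
  p∣n = m∣m*n q

  difference : ∀ x y → toℕ y ≡ (toℕ x ℕ.+ toℕ ((⊖ x) ⊕ y)) ℕ.% n
  difference x y = trans (cong toℕ y≡) (toℕ-mod (toℕ x ℕ.+ toℕ ((⊖ x) ⊕ y)))
    where
    y≡ : y ≡ x ⊕ ((⊖ x) ⊕ y)
    y≡ = trans (sym (⊕-identityˡ y)) (trans (cong (_⊕ y) (sym (trans (⊕-comm x (⊖ x)) (⊕-inverseˡ x)))) (⊕-assoc x (⊖ x) y))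

  residue : ∀ x y → toℕ y ℕ.% p ≡ (toℕ x ℕ.+ toℕ ((⊖ x) ⊕ y)) ℕ.% p
  residue x y = trans (cong (ℕ._% p) (difference x y)) (m∣n⇒o%n%m≡o%m p n _ p∣n)

  -- A difference is a unit modulo `p ^ suc m` exactly when `p` does not divide it. Non-adjacency is
  -- therefore congruence modulo `p`, with `p` classes of `p ^ m` residues each.
  part : Fin n → Fin p
  part x = toℕ x mod p

  toℕ-part : ∀ x → toℕ (part x) ≡ toℕ x ℕ.% p
  toℕ-part x = IntegersMod.toℕ-mod p (toℕ x)

  ≁⇒part≡ : ∀ {x y} → ¬ (x ~ y) → part x ≡ part y
  ≁⇒part≡ {x} {y} x≁y = Fin.toℕ-injective (begin
    toℕ (part x)                                 ≡⟨ toℕ-part x ⟩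
    toℕ x ℕ.% p                                  ≡⟨ %-remove-+ʳ (toℕ x) p∣d ⟨
    (toℕ x ℕ.+ toℕ ((⊖ x) ⊕ y)) ℕ.% p            ≡⟨ residue x y ⟨
    toℕ y ℕ.% p                                  ≡⟨ toℕ-part y ⟨
    toℕ (part y)                                 ∎)
    where
    open ≡-Reasoning
    p∣d : p ∣ toℕ ((⊖ x) ⊕ y)
    p∣d = decidable-stable (p ∣? toℕ ((⊖ x) ⊕ y)) λ p∤d → x≁y (coprime⇒gcd≡1 (∤⇒coprime-^ p-prime p∤d (suc m)))

  part≡⇒≁ : ∀ {x y} → part x ≡ part y → ¬ (x ~ y)
  part≡⇒≁ {x} {y} eq x~y = ¬prime[1] (subst Prime (gcd≡1⇒coprime x~y (p∣d , p∣n)) p-prime)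
    where
    p∣d : p ∣ toℕ ((⊖ x) ⊕ y)
    p∣d = m+n≡m[mod]⇒∣n (toℕ x) _ p (trans (sym (residue x y)) (trans (sym (toℕ-part y)) (trans (cong toℕ (sym eq)) (toℕ-part x))))

  q*p≡n : q ℕ.* p ≡ n
  q*p≡n = ℕ.*-comm q p

  pick : Fin q → Fin p → Fin n
  pick i j = cast q*p≡n (combine i j)

  toℕ-pick : ∀ i j → toℕ (pick i j) ≡ p ℕ.* toℕ i ℕ.+ toℕ j
  toℕ-pick i j = trans (Fin.toℕ-cast q*p≡n (combine i j)) (Fin.toℕ-combine i j)

  multipartite : Multipartite Γ p q
  multipartite = record
    { part      = part
    ; ≁⇒part≡   = ≁⇒part≡
    ; part≡⇒≁   = part≡⇒≁
    ; pick      = pick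
    ; part-pick = λ i j → Fin.toℕ-injective (begin
        toℕ (part (pick i j))                    ≡⟨ toℕ-part (pick i j) ⟩
        toℕ (pick i j) ℕ.% p                     ≡⟨ cong (ℕ._% p) (toℕ-pick i j) ⟩
        (p ℕ.* toℕ i ℕ.+ toℕ j) ℕ.% p            ≡⟨ %-remove-+ˡ (toℕ j) (m∣m*n (toℕ i)) ⟩
        toℕ j ℕ.% p                              ≡⟨ m<n⇒m%n≡m (Fin.toℕ<n j) ⟩
        toℕ j                                    ∎)
    ; pick-inj  = λ i i′ j eq → Fin.toℕ-injective (ℕ.*-cancelˡ-≡ (toℕ i) (toℕ i′) p (ℕ.+-cancelʳ-≡ (toℕ j) _ _
        (trans (sym (toℕ-pick i j)) (trans (cong toℕ eq) (toℕ-pick i′ j)))))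
    ; ∑-pick    = λ f → trans (∑-cast q*p≡n f) (∑-combine q _)
    }
    where open ≡-Reasoning

proposition3p4 : ∀ {c ℓ₁ ℓ₂} (K : HeytingField c ℓ₁ ℓ₂) → Laplacian.CharacteristicZero K →
    ∀ (p m v : ℕ) (p-prime : Prime p) (m≥1 : 1 ≤ m) → 1 ≤ v →
    Laplacian.LaplacianDS K (complete v ▽ unitaryCayley (p ^ m) {{primePower-nonTrivial p-prime m≥1}})
proposition3p4 K char0 p (suc m) v p-prime (s≤s z≤n) _ {k} H same = iso (q ℕ.≟ 1)
  where
  open ≡-Reasoning
  q n : ℕ
  q = p ^ m
  n = p ^ suc m
  instance
    q-nonZero : ℕ.NonZero q
    q-nonZero = ℕ.m^n≢0 p m {{prime⇒nonZero p-prime}}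

  open PrimePower p-prime m using (Γ; multipartite)
  open Cone v Γ multipartite using (G; clustered; nontrivial-cell; ∑-cell)
  module CG = Cells G
  module CH = Cells H
  open Traces CH.L CG.L (sameSpectrum⇒χ K char0 G H same) using (tr-unique)
  open SameGram CH.L CG.L CH.L-sym CH.L-row CG.L-sym CG.L-row tr-unique using (size≡; combination-0)

  H-clustered : Clustered H q
  -- The coefficients contain the number of vertices, written `k` for `H` and `v + n` for `G`;
  -- `size≡` reconciles the two.
  H-clustered = Q≡0⇒clustered H q (subst (λ a → ∀ i j → combination (coefficients a (+ q)) CH.L i j ≡ 0ℤ) (sym size≡)
    (combination-0 (coefficients (v ℕ.+ n) (+ q)) (clustered⇒Q≡0 G q clustered nontrivial-cell)))

  ∑-complement : ∀ {a} (b : ℤ) (f : Fin a → ℤ) → ∑ (λ i → b - f i) ≡ + a * b - ∑ f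
  ∑-complement {a} b f = trans (∑-cong λ i → cong (λ z → b + z) (sym (ℤ.-1*i≡-i (f i)))) (trans
    (∑-+ (λ _ → b) (λ i → -1ℤ * f i))
    (cong₂ _+_ (∑-const a b) (trans (∑-*ˡ -1ℤ f) (ℤ.-1*i≡-i (∑ f)))))

  -- The trace of a Laplacian is the sum of degrees, that is, the squared vertex count minus the sum
  -- of cell sizes; trace and vertex count are both shared with `G`.
  ∑e≡ : ∑ CH.e ≡ + (v ℕ.+ n ℕ.* q)
  ∑e≡ = trans (ℤ.neg-injective (ℤ+.∙-cancelˡ (+ k * + k) (- ∑ CH.e) (- ∑ CG.e) (begin
    + k * + k - ∑ CH.e                           ≡⟨ ∑-complement (+ k) CH.e ⟨
    ∑ (λ i → + k - CH.e i)                       ≡⟨ CH.tr-pow-1 ⟨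
    tr (pow CH.L 1)                              ≡⟨ tr-unique 1 ⟩
    tr (pow CG.L 1)                              ≡⟨ CG.tr-pow-1 ⟩
    ∑ (λ i → + (v ℕ.+ n) - CG.e i)               ≡⟨ ∑-complement (+ (v ℕ.+ n)) CG.e ⟩
    + (v ℕ.+ n) * + (v ℕ.+ n) - ∑ CG.e           ≡⟨ cong (λ a → + a * + a - ∑ CG.e) size≡ ⟨
    + k * + k - ∑ CG.e                           ∎))) ∑-cell

  cells≡1 : q ≡ 1 → ∀ {a} {F : Graph a} → Clustered F q → ∀ i → Cells.cell F i ≡ 1
  cells≡1 q≡1 F-clustered i = [ (λ eq → eq) , (λ eq → trans eq q≡1) ]′ (Clustered.cell-size F-clustered i)

  iso : Dec (q ≡ 1) → H ≅ G
  iso (yes q≡1) = complete-iso H G size≡ (cells≡1 q≡1 H-clustered) (cells≡1 q≡1 clustered)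
  iso (no  q≢1) = Isomorphism.large-iso v Γ multipartite H H-clustered size≡ ∑e≡ q≢1
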